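{- Let $\mathcal{L}$ be a logic containing $\mathcal{H}$ and contained in first-order logic $\mathsf{FO}$. Then the following problem is undecidable: given $\varphi\in\mathcal{L}$ and a signature $\sigma$, does there exist a uniform $\mathcal{L}(\sigma)$-interpolant for $\varphi$ (in $\mathcal{L}$)?
   Context: Let $\mathsf{Rel},\mathsf{Var},\mathsf{Nom}$ be countably infinite disjoint sets of binary relation symbols, propositional variables and nominals. Formulae of $\mathcal{H}$ are given by $\varphi,\psi::=\top\mid p\mid a\mid\neg\varphi\mid\varphi\wedge\psi\mid\langle R\rangle\varphi$ with $p\in\mathsf{Var}$, $a\in\mathsf{Nom}$, $R\in\mathsf{Rel}$. A model $\mathcal{M}$ has a domain $W$ and interprets each $R\in\mathsf{Rel}$ as $R^{\mathcal{M}}\subseteq W\times W$, each $p\in\mathsf{Var}$ as $p^{\mathcal{M}}\subseteq W$, and each $a\in\mathsf{Nom}$ as an element $a^{\mathcal{M}}\in W$. Satisfaction is standard; in particular $\mathcal{M},w\models a$ iff $w=a^{\mathcal{M}}$, and $\mathcal{M},w\models\langle R\rangle\varphi$ iff $\mathcal{M},v\models\varphi$ for some $(w,v)\in R^{\mathcal{M}}$. Via the standard translation $T_x$, mapping each $\mathcal{H}$-formula $\varphi$ to an $\mathsf{FO}$-formula $T_x(\varphi)$ with one free variable $x$ such that $\mathcal{M},w\models\varphi$ iff $\mathcal{M}\models T_x(\varphi)(w)$ (relation symbols being binary predicates, propositional variables unary predicates, and nominals constants), $\mathcal{H}$ is regarded as a fragment of $\mathsf{FO}$. A signature is a finite subset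 of $\mathsf{Rel}\cup\mathsf{Var}\cup\mathsf{Nom}$, and $\mathrm{sig}(\varphi)$ is the set of all such symbols occurring in $\varphi$. $\varphi\models\psi$ means that every pointed model of $\varphi$ is one of $\psi$. For $\varphi\in\mathcal{L}$ and a signature $\sigma$, a uniform $\mathcal{L}(\sigma)$-interpolant for $\varphi$ (in $\mathcal{L}$) is a formula $\chi\in\mathcal{L}$ with $\mathrm{sig}(\chi)\subseteq\sigma$ such that (1) $\varphi\models\chi$, and (2) for every $\psi\in\mathcal{L}$ with $\varphi\models\psi$ and $\mathrm{sig}(\psi)\cap\mathrm{sig}(\varphi)\subseteq\sigma$, we have $\chi\models\psi$. -}

module Defs where

open import Data.Fin using (Fin; zero; suc; toℕ)
open import Data.Fin.Properties using (toℕ-injective)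
open import Data.List using (List; []; _∷_; _++_)
open import Data.List.Membership.Propositional using (_∈_)
open import Data.List.Relation.Binary.Subset.Propositional using (_⊆_)
open import Data.Nat using (ℕ; zero; suc; _+_; _≤_; _<_; z≤n; s≤s)
open import Data.Nat.Properties
open import Data.Product using (Σ; ∃; _×_; _,_; proj₁; proj₂; uncurry)
open import Data.Unit using (⊤; tt)
open import Data.Vec using (Vec; []; _∷_; [_]; lookup)
open import Function using (_⇔_; mk⇔; Equivalence)
open import Level using (Level; _⊔_) renaming (suc to lsuc)
open import Relation.Binary using (tri<; tri≈; tri>)
open import Relation.Binary.PropositionalEquality
  using (_≡_; refl; sym; trans; cong; cong₂)
open import Relation.Nullary using (¬_; contradiction)
open import Relation.Unary using (Pred)

Rel Var Nom : Set
Rel = ℕ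
Var = ℕ
Nom = ℕ

data Symbol : Set where
  rel : Rel → Symbol
  var : Var → Symbol
  nom : Nom → Symbol

-- A list presents the finite set of its members; order and repetitions
-- are irrelevant except for the Gödel number of the presentation.
Signature : Set
Signature = List Symbol

record Model : Set₁ where
  field
    W    : Set
    relᴹ : Rel → W → W → Set
    varᴹ : Var → W → Set
    nomᴹ : Nom → W

open Model public

infix  9 ¬ᴴ_ ⟨_⟩_
infixr 8 _∧ᴴ_

data H : Set where
  ⊤ᴴ   : H
  varᴴ : Var → H
  nomᴴ : Nom → H
  ¬ᴴ_  : H → H
  _∧ᴴ_ : H → H → H
  ⟨_⟩_ : Rel → H → H

infix 4 _,_⊨ᴴ_

_,_⊨ᴴ_ : (M : Model) → W M → H → Set
M , w ⊨ᴴ ⊤ᴴ      = ⊤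
M , w ⊨ᴴ varᴴ p  = varᴹ M p w
M , w ⊨ᴴ nomᴴ a  = w ≡ nomᴹ M a
M , w ⊨ᴴ ¬ᴴ φ    = ¬ (M , w ⊨ᴴ φ)
M , w ⊨ᴴ φ ∧ᴴ ψ  = (M , w ⊨ᴴ φ) × (M , w ⊨ᴴ ψ)
M , w ⊨ᴴ ⟨ R ⟩ φ = ∃ λ v → relᴹ M R w v × (M , v ⊨ᴴ φ)

-- FO n: first-order formulae with equality, up to renaming of bound
-- variables, whose free variables are among n given ones (de Bruijn
-- indices; ∃ᶠ binds index zero).

data Term (n : ℕ) : Set where
  var : Fin n → Term n
  nom : Nom → Term n

infix  10 _≐_
infix  9 ¬ᶠ_ ∃ᶠ_
infixr 8 _∧ᶠ_

data FO (n : ℕ) : Set where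
  ⊤ᶠ   : FO n
  _≐_  : Term n → Term n → FO n
  varᶠ : Var → Term n → FO n
  relᶠ : Rel → Term n → Term n → FO n
  ¬ᶠ_  : FO n → FO n
  _∧ᶠ_ : FO n → FO n → FO n
  ∃ᶠ_  : FO (suc n) → FO n

⟦_⟧ᵗ : ∀ {n} → Term n → (M : Model) → Vec (W M) n → W M
⟦ var x ⟧ᵗ M ρ = lookup ρ x
⟦ nom a ⟧ᵗ M ρ = nomᴹ M a

infix 4 _,_⊨ᶠ_

_,_⊨ᶠ_ : ∀ {n} (M : Model) → Vec (W M) n → FO n → Set
M , ρ ⊨ᶠ ⊤ᶠ         = ⊤
M , ρ ⊨ᶠ s ≐ t      = ⟦ s ⟧ᵗ M ρ ≡ ⟦ t ⟧ᵗ M ρ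
M , ρ ⊨ᶠ varᶠ p t   = varᴹ M p (⟦ t ⟧ᵗ M ρ)
M , ρ ⊨ᶠ relᶠ R s t = relᴹ M R (⟦ s ⟧ᵗ M ρ) (⟦ t ⟧ᵗ M ρ)
M , ρ ⊨ᶠ ¬ᶠ φ       = ¬ (M , ρ ⊨ᶠ φ)
M , ρ ⊨ᶠ φ ∧ᶠ ψ     = (M , ρ ⊨ᶠ φ) × (M , ρ ⊨ᶠ ψ)
M , ρ ⊨ᶠ ∃ᶠ φ       = ∃ λ w → M , w ∷ ρ ⊨ᶠ φ

sigᵗ : ∀ {n} → Term n → Signature
sigᵗ (var x) = []
sigᵗ (nom a) = nom a ∷ []

sig : ∀ {n} → FO n → Signature
sig ⊤ᶠ           = []
sig (s ≐ t)      = sigᵗ s ++ sigᵗ t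
sig (varᶠ p t)   = var p ∷ sigᵗ t
sig (relᶠ R s t) = rel R ∷ sigᵗ s ++ sigᵗ t
sig (¬ᶠ φ)       = sig φ
sig (φ ∧ᶠ ψ)     = sig φ ++ sig ψ
sig (∃ᶠ φ)       = sig φ

T : ∀ {n} → Fin n → H → FO n
T x ⊤ᴴ        = ⊤ᶠ
T x (varᴴ p)  = varᶠ p (var x)
T x (nomᴴ a)  = var x ≐ nom a
T x (¬ᴴ φ)    = ¬ᶠ T x φ
T x (φ ∧ᴴ ψ)  = T x φ ∧ᶠ T x ψ
T x (⟨ R ⟩ φ) = ∃ᶠ (relᶠ R (var (suc x)) (var zero) ∧ᶠ T zero φ)

T-correct : ∀ {n} M (ρ : Vec (W M) n) x φ →
            (M , lookup ρ x ⊨ᴴ φ) ⇔ (M , ρ ⊨ᶠ T x φ)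
T-correct M ρ x ⊤ᴴ       = mk⇔ (λ h → h) (λ h → h)
T-correct M ρ x (varᴴ p) = mk⇔ (λ h → h) (λ h → h)
T-correct M ρ x (nomᴴ a) = mk⇔ (λ h → h) (λ h → h)
T-correct M ρ x (¬ᴴ φ)   =
  mk⇔ (λ h k → h (from k)) (λ h k → h (to k))
  where open Equivalence (T-correct M ρ x φ)
T-correct M ρ x (φ ∧ᴴ ψ) =
  mk⇔ (λ (h , k) → I.to h , J.to k) (λ (h , k) → I.from h , J.from k)
  where module I = Equivalence (T-correct M ρ x φ)
        module J = Equivalence (T-correct M ρ x ψ)
T-correct M ρ x (⟨ R ⟩ φ) =
  mk⇔ (λ (v , r , h) → v , r , to   (T-correct M (v ∷ ρ) zero φ) h)
      (λ (v , r , h) → v , r , from (T-correct M (v ∷ ρ) zero φ) h)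
  where open Equivalence

infix 4 _⊨_

_⊨_ : FO 1 → FO 1 → Set₁
φ ⊨ ψ = ∀ M (w : W M) → M , [ w ] ⊨ᶠ φ → M , [ w ] ⊨ᶠ ψ

-- A logic contained in FO is a set of formulae with at most one free
-- variable.  No closure conditions are imposed.
Logic : ∀ ℓ → Set (lsuc ℓ)
Logic ℓ = Pred (FO 1) ℓ

ContainsH : ∀ {ℓ} → Logic ℓ → Set ℓ
ContainsH L = ∀ φ → L (T zero φ)

record IsUniformInterpolant {ℓ} (L : Logic ℓ) (σ : Signature)
                            (φ χ : FO 1) : Set (lsuc Level.zero ⊔ ℓ) where
  field
    χ∈L       : L χ
    sigχ⊆σ    : sig χ ⊆ σ
    φ⊨χ       : φ ⊨ χ
    strongest : ∀ ψ → L ψ → φ ⊨ ψ →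
                (∀ {s} → s ∈ sig ψ → s ∈ sig φ → s ∈ σ) → χ ⊨ ψ

Instance : ∀ {ℓ} → Logic ℓ → Set ℓ
Instance L = Σ (FO 1) L × Signature

HasUniformInterpolant : ∀ {ℓ} (L : Logic ℓ) →
                        Pred (Instance L) (lsuc Level.zero ⊔ ℓ)
HasUniformInterpolant L ((φ , _) , σ) = ∃ (IsUniformInterpolant L σ φ)

-- n-ary partial recursive functions (primitive recursion and unbounded
-- minimisation), with their graphs given by _⟦_⟧⇓_.
data Rec : ℕ → Set where
  zero : ∀ {n} → Rec n
  suc  : Rec 1
  proj : ∀ {n} → Fin n → Rec n
  comp : ∀ {m n} → Rec m → Vec (Rec n) m → Rec n
  prec : ∀ {n} → Rec n → Rec (2 + n) → Rec (suc n)
  min  : ∀ {n} → Rec (suc n) → Rec n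

infix 4 _⟦_⟧⇓_

data _⟦_⟧⇓_ : ∀ {n} → Rec n → Vec ℕ n → ℕ → Set where
  ⇓zero  : ∀ {n} {xs : Vec ℕ n} → zero ⟦ xs ⟧⇓ 0
  ⇓suc   : ∀ {x} → suc ⟦ x ∷ [] ⟧⇓ suc x
  ⇓proj  : ∀ {n} {xs : Vec ℕ n} i → proj i ⟦ xs ⟧⇓ lookup xs i
  ⇓comp  : ∀ {m n} {f : Rec m} {gs : Vec (Rec n) m} {xs} ys {z} →
           (∀ i → lookup gs i ⟦ xs ⟧⇓ lookup ys i) →
           f ⟦ ys ⟧⇓ z → comp f gs ⟦ xs ⟧⇓ z
  ⇓prec₀ : ∀ {n} {f : Rec n} {g xs z} →
           f ⟦ xs ⟧⇓ z → prec f g ⟦ 0 ∷ xs ⟧⇓ z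
  ⇓precₛ : ∀ {n} {f : Rec n} {g xs k y z} →
           prec f g ⟦ k ∷ xs ⟧⇓ y → g ⟦ k ∷ y ∷ xs ⟧⇓ z →
           prec f g ⟦ suc k ∷ xs ⟧⇓ z
  ⇓min   : ∀ {n} {f : Rec (suc n)} {xs y} →
           f ⟦ y ∷ xs ⟧⇓ 0 →
           (∀ {k} → k < y → ∃ λ v → f ⟦ k ∷ xs ⟧⇓ suc v) →
           min f ⟦ xs ⟧⇓ y

-- f halts with the right answer on every code of an instance; nothing
-- is required of f on other numbers.
Decides : ∀ {i p} {I : Set i} → (I → ℕ) → Pred I p → Rec 1 → Set (i ⊔ p)
Decides code P f = ∀ x → (P x   → f ⟦ code x ∷ [] ⟧⇓ 1)
                       × (¬ P x → f ⟦ code x ∷ [] ⟧⇓ 0)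

Undecidable : ∀ {i p} {I : Set i} → (I → ℕ) → Pred I p → Set (i ⊔ p)
Undecidable code P = ¬ ∃ (Decides code P)

triangle : ℕ → ℕ
triangle zero    = 0
triangle (suc n) = suc n + triangle n

-- The Cantor pairing function, a bijection ℕ × ℕ → ℕ.
pair : ℕ → ℕ → ℕ
pair a b = triangle (a + b) + b

codeSymbol : Symbol → ℕ
codeSymbol (rel R) = pair 0 R
codeSymbol (var p) = pair 1 p
codeSymbol (nom a) = pair 2 a

codeSignature : Signature → ℕ
codeSignature []      = 0
codeSignature (s ∷ σ) = suc (pair (codeSymbol s) (codeSignature σ))

codeTerm : ∀ {n} → Term n → ℕ
codeTerm (var x) = pair 0 (toℕ x)
codeTerm (nom a) = pair 1 a

mutual

  codeFO : ∀ {n} → FO n → ℕ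
  codeFO φ = uncurry pair (fields φ)

  fields : ∀ {n} → FO n → ℕ × ℕ
  fields ⊤ᶠ           = 0 , 0
  fields (s ≐ t)      = 1 , pair (codeTerm s) (codeTerm t)
  fields (varᶠ p t)   = 2 , pair p (codeTerm t)
  fields (relᶠ R s t) = 3 , pair R (pair (codeTerm s) (codeTerm t))
  fields (¬ᶠ φ)       = 4 , codeFO φ
  fields (φ ∧ᶠ ψ)     = 5 , pair (codeFO φ) (codeFO ψ)
  fields (∃ᶠ φ)       = 6 , codeFO φ

codeInstance : ∀ {ℓ} (L : Logic ℓ) → Instance L → ℕ
codeInstance L ((φ , _) , σ) = pair (codeFO φ) (codeSignature σ)

-- The lemmas below show that distinct formulae, and distinct lists of
-- symbols, have distinct codes, so the numbering loses no information.

triangle-mono : ∀ {m n} → m ≤ n → triangle m ≤ triangle n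
triangle-mono z≤n     = z≤n
triangle-mono (s≤s p) = +-mono-≤ (s≤s p) (triangle-mono p)

pair-< : ∀ a b c d → a + b < c + d → pair a b < pair c d
pair-< a b c d a+b<c+d = begin-strict
  triangle (a + b) + b         ≤⟨ +-monoʳ-≤ (triangle (a + b)) (m≤n+m b a) ⟩
  triangle (a + b) + (a + b)   ≡⟨ +-comm (triangle (a + b)) (a + b) ⟩
  (a + b) + triangle (a + b)   <⟨ n<1+n _ ⟩
  triangle (suc (a + b))       ≤⟨ triangle-mono a+b<c+d ⟩
  triangle (c + d)             ≤⟨ m≤m+n _ d ⟩
  triangle (c + d) + d         ∎
  where open ≤-Reasoning

pair-injective : ∀ a b c d → pair a b ≡ pair c d → a ≡ c × b ≡ d
pair-injective a b c d eq with <-cmp (a + b) (c + d)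
... | tri< lt _ _ = contradiction eq (<⇒≢ (pair-< a b c d lt))
... | tri> _ _ gt = contradiction (sym eq) (<⇒≢ (pair-< c d a b gt))
... | tri≈ _ s≡ _ = +-cancelʳ-≡ b a c (trans s≡ (cong (c +_) (sym b≡d))) , b≡d
  where
  b≡d : b ≡ d
  b≡d = +-cancelˡ-≡ (triangle (a + b)) b d
          (trans eq (cong (λ s → triangle s + d) (sym s≡)))

codeSymbol-injective : ∀ s t → codeSymbol s ≡ codeSymbol t → s ≡ t
codeSymbol-injective (rel R) (rel S) eq = cong rel (proj₂ (pair-injective 0 R 0 S eq))
codeSymbol-injective (var p) (var q) eq = cong var (proj₂ (pair-injective 1 p 1 q eq))
codeSymbol-injective (nom a) (nom b) eq = cong nom (proj₂ (pair-injective 2 a 2 b eq))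
codeSymbol-injective (rel R) (var q) eq = contradiction (proj₁ (pair-injective 0 R 1 q eq)) λ ()
codeSymbol-injective (rel R) (nom b) eq = contradiction (proj₁ (pair-injective 0 R 2 b eq)) λ ()
codeSymbol-injective (var p) (rel S) eq = contradiction (proj₁ (pair-injective 1 p 0 S eq)) λ ()
codeSymbol-injective (var p) (nom b) eq = contradiction (proj₁ (pair-injective 1 p 2 b eq)) λ ()
codeSymbol-injective (nom a) (rel S) eq = contradiction (proj₁ (pair-injective 2 a 0 S eq)) λ ()
codeSymbol-injective (nom a) (var q) eq = contradiction (proj₁ (pair-injective 2 a 1 q eq)) λ ()

codeSignature-injective : ∀ σ τ → codeSignature σ ≡ codeSignature τ → σ ≡ τ
codeSignature-injective []      []      eq = refl
codeSignature-injective (s ∷ σ) (t ∷ τ) eq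
  with pair-injective (codeSymbol s) (codeSignature σ)
                      (codeSymbol t) (codeSignature τ) (suc-injective eq)
... | p , q = cong₂ _∷_ (codeSymbol-injective s t p) (codeSignature-injective σ τ q)

codeTerm-injective : ∀ {n} (s t : Term n) → codeTerm s ≡ codeTerm t → s ≡ t
codeTerm-injective (var x) (var y) eq =
  cong var (toℕ-injective (proj₂ (pair-injective 0 (toℕ x) 0 (toℕ y) eq)))
codeTerm-injective (nom a) (nom b) eq = cong nom (proj₂ (pair-injective 1 a 1 b eq))
codeTerm-injective (var x) (nom b) eq = contradiction (proj₁ (pair-injective 0 (toℕ x) 1 b eq)) λ ()
codeTerm-injective (nom a) (var y) eq = contradiction (proj₁ (pair-injective 1 a 0 (toℕ y) eq)) λ ()

mutual

  codeFO-injective : ∀ {n} (φ ψ : FO n) → codeFO φ ≡ codeFO ψ → φ ≡ ψ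
  codeFO-injective φ ψ eq
    with pair-injective (proj₁ (fields φ)) (proj₂ (fields φ))
                        (proj₁ (fields ψ)) (proj₂ (fields ψ)) eq
  ... | p , q = fields-injective φ ψ p q

  fields-injective : ∀ {n} (φ ψ : FO n) →
                     proj₁ (fields φ) ≡ proj₁ (fields ψ) →
                     proj₂ (fields φ) ≡ proj₂ (fields ψ) → φ ≡ ψ
  fields-injective ⊤ᶠ ⊤ᶠ _ _ = refl
  fields-injective (s ≐ t) (s′ ≐ t′) _ eq
    with pair-injective (codeTerm s) (codeTerm t) (codeTerm s′) (codeTerm t′) eq
  ... | p , q = cong₂ _≐_ (codeTerm-injective s s′ p) (codeTerm-injective t t′ q)
  fields-injective (varᶠ p t) (varᶠ p′ t′) _ eq
    with pair-injective p (codeTerm t) p′ (codeTerm t′) eq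
  ... | e , q = cong₂ varᶠ e (codeTerm-injective t t′ q)
  fields-injective (relᶠ R s t) (relᶠ R′ s′ t′) _ eq
    with pair-injective R (pair (codeTerm s) (codeTerm t))
                        R′ (pair (codeTerm s′) (codeTerm t′)) eq
  ... | refl , e
    with pair-injective (codeTerm s) (codeTerm t) (codeTerm s′) (codeTerm t′) e
  ... | p , q = cong₂ (relᶠ R) (codeTerm-injective s s′ p) (codeTerm-injective t t′ q)
  fields-injective (¬ᶠ φ) (¬ᶠ ψ) _ eq = cong ¬ᶠ_ (codeFO-injective φ ψ eq)
  fields-injective (φ ∧ᶠ χ) (φ′ ∧ᶠ χ′) _ eq
    with pair-injective (codeFO φ) (codeFO χ) (codeFO φ′) (codeFO χ′) eq
  ... | p , q = cong₂ _∧ᶠ_ (codeFO-injective φ φ′ p) (codeFO-injective χ χ′ q)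
  fields-injective (∃ᶠ φ) (∃ᶠ ψ) _ eq = cong ∃ᶠ_ (codeFO-injective φ ψ eq)

{-# OPTIONS --safe #-}
-- Suppose f decides the problem.  A program h that applies f to an instance
-- built from two seeds a, b is encoded in a formula φ = ¬ (theory h ∧ root a b).
-- Its hidden symbols (a nominal c and a variable p) act as existential
-- second-order quantifiers, so that φ says "some c violates a local law of
-- computation, or p witnesses that a grid is infinite".  The laws state that
-- every value recorded in a model is justified by earlier ones, and root a b
-- records a nonzero value for h at (a , b).
--
-- If h yields 0 at (a , b), then induction on the computation shows that the laws
-- cannot all hold, so φ is satisfied by choosing c suitably in any model and ⊤ is a
-- uniform interpolant.  If h yields 1, then the bounded part of its computation is
-- a finite model of the laws.  Add to it a square grid on D: with D = ℕ the model
-- satisfies φ, hence any interpolant χ; by an Ehrenfeucht-Fraïssé game it then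
-- satisfies χ also with D = Fin n for n large, although its diagram, written with
-- fresh nominals, refutes φ.  Taking as seeds the Gödel numbers of theory h and of
-- the signature makes the instance speak about its own decision by f.
module Submission where

open import Axiom.ExcludedMiddle using (ExcludedMiddle)
open import Data.Empty using (⊥; ⊥-elim)
open import Data.Fin using (Fin; zero; suc; toℕ)
open import Data.Fin.Properties using (injective⇒≤; toℕ-injective)
open import Data.List
  using (List; []; _∷_; _++_; length; map; replicate; upTo; allFin; cartesianProductWith)
open import Data.List.Membership.Propositional using (_∈_)
open import Data.List.Membership.Propositional.Properties
  using (∈-++⁺ˡ; ∈-++⁺ʳ; ∈-++⁻; ∈-map⁺; ∈-upTo⁺; ∈-allFin; ∈-cartesianProductWith⁺)
open import Data.List.Properties using (length-replicate)
open import Data.List.Relation.Binary.Subset.Propositional using (_⊆_)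
open import Data.List.Relation.Unary.All as All using (All; []; _∷_)
open import Data.List.Relation.Unary.Any using (here; there)
open import Data.Nat using (ℕ; zero; suc; _+_; _⊔_; _≤_; _<_; z≤n; s≤s)
open import Data.Nat.Properties
  using (≤-refl; ≤-reflexive; ≤-trans; <⇒≤; <⇒≱; 1+n≰n; m≤n⇒m<n∨m≡n; m≤n⇒m≤1+n;
         m≤m⊔n; m≤n⊔m; m≤m+n; m≤n+m; +-suc; +-identityʳ; +-monoʳ-≤; suc-injective)
open import Data.Product using (∃; _×_; _,_; proj₁; proj₂)
open import Data.Sum using (_⊎_; inj₁; inj₂; [_,_]′)
open import Data.Unit using (⊤; tt)
open import Data.Vec using (Vec; []; _∷_; [_]; lookup; toList)
open import Function using (_⇔_; mk⇔; Equivalence; _∘_; id)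
open import Level using (0ℓ)
open import Relation.Binary.PropositionalEquality
  using (_≡_; _≢_; refl; sym; trans; cong; cong₂; subst)
open import Relation.Nullary using (¬_; Dec; yes; no; contradiction)
open import Relation.Nullary.Decidable using (decidable-stable)
open import Defs

-- Recursive functions that compute codes of formulae

⇓comp₁ : ∀ {n f} {g : Rec n} {xs y z} →
         g ⟦ xs ⟧⇓ y → f ⟦ y ∷ [] ⟧⇓ z → comp f (g ∷ []) ⟦ xs ⟧⇓ z
⇓comp₁ d = ⇓comp (_ ∷ []) λ { zero → d }

⇓comp₂ : ∀ {n f} {g₁ g₂ : Rec n} {xs y₁ y₂ z} →
         g₁ ⟦ xs ⟧⇓ y₁ → g₂ ⟦ xs ⟧⇓ y₂ → f ⟦ y₁ ∷ y₂ ∷ [] ⟧⇓ z →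
         comp f (g₁ ∷ g₂ ∷ []) ⟦ xs ⟧⇓ z
⇓comp₂ d₁ d₂ = ⇓comp (_ ∷ _ ∷ []) λ { zero → d₁ ; (suc zero) → d₂ }

constᴿ : ∀ {n} → ℕ → Rec n
constᴿ zero    = zero
constᴿ (suc k) = comp suc (constᴿ k ∷ [])

const⇓ : ∀ {n} k {xs : Vec ℕ n} → constᴿ k ⟦ xs ⟧⇓ k
const⇓ zero    = ⇓zero
const⇓ (suc k) = ⇓comp₁ (const⇓ k) ⇓suc

addᴿ : Rec 2
addᴿ = prec (proj zero) (comp suc (proj (suc zero) ∷ []))

add⇓ : ∀ a {b} → addᴿ ⟦ a ∷ b ∷ [] ⟧⇓ (a + b)
add⇓ zero    = ⇓prec₀ (⇓proj zero)
add⇓ (suc a) = ⇓precₛ (add⇓ a) (⇓comp₁ (⇓proj (suc zero)) ⇓suc)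

triangleᴿ : Rec 1
triangleᴿ = prec zero (comp addᴿ (comp suc (proj zero ∷ []) ∷ proj (suc zero) ∷ []))

triangle⇓ : ∀ a → triangleᴿ ⟦ a ∷ [] ⟧⇓ triangle a
triangle⇓ zero    = ⇓prec₀ ⇓zero
triangle⇓ (suc a) =
  ⇓precₛ (triangle⇓ a)
         (⇓comp₂ (⇓comp₁ (⇓proj zero) ⇓suc) (⇓proj (suc zero)) (add⇓ (suc a)))

cantorᴿ : Rec 2
cantorᴿ = comp addᴿ (comp triangleᴿ (addᴿ ∷ []) ∷ proj (suc zero) ∷ [])

pairᴿ : ∀ {n} → Rec n → Rec n → Rec n
pairᴿ f g = comp cantorᴿ (f ∷ g ∷ [])

pair⇓ : ∀ {n f g} {xs : Vec ℕ n} {a b} →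
        f ⟦ xs ⟧⇓ a → g ⟦ xs ⟧⇓ b → pairᴿ f g ⟦ xs ⟧⇓ pair a b
pair⇓ {a = a} {b} d e = ⇓comp₂ d e
  (⇓comp₂ (⇓comp₁ (add⇓ a) (triangle⇓ (a + b))) (⇓proj (suc zero)) (add⇓ (triangle (a + b))))

-- Abstract because type checking would otherwise evaluate astronomical numbers.
abstract

  code : ∀ {n} → FO n → ℕ
  code = codeFO

notᴿ : ∀ {n} → Rec n → Rec n
notᴿ f = pairᴿ (constᴿ 4) f

andᴿ : ∀ {n} → Rec n → Rec n → Rec n
andᴿ f g = pairᴿ (constᴿ 5) (pairᴿ f g)

diamondᴿ : ∀ {n} → Rel → Rec n → Rec n
diamondᴿ R f =
  pairᴿ (constᴿ 6) (andᴿ (constᴿ (code {2} (relᶠ R (var (suc zero)) (var zero)))) f)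

boxᴿ : ∀ {n} → Rel → Rec n → Rec n
boxᴿ R f = notᴿ (diamondᴿ R (notᴿ f))

module _ {k} {xs : Vec ℕ k} where

  infix 4 _⇓code_

  _⇓code_ : ∀ {n} → Rec k → FO n → Set
  f ⇓code φ = f ⟦ xs ⟧⇓ code φ

  abstract

    -- Codes ignore the size of the scope, and `T zero` refers to the current point always by the
    -- index zero, so one constant serves under any number of quantifiers.
    atom⇓ : ∀ {m} v → constᴿ (code {1} (T zero (varᴴ v))) ⇓code T {suc m} zero (varᴴ v)
    atom⇓ v = const⇓ _

    not⇓ : ∀ {f n} {φ : FO n} → f ⇓code φ → notᴿ f ⇓code ¬ᶠ φ
    not⇓ d = pair⇓ (const⇓ 4) d

    and⇓ : ∀ {f g n} {φ ψ : FO n} → f ⇓code φ → g ⇓code ψ → andᴿ f g ⇓code φ ∧ᶠ ψ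
    and⇓ d e = pair⇓ (const⇓ 5) (pair⇓ d e)

    diamond⇓ : ∀ {f m} R (φ : H) → f ⇓code T {2 + m} zero φ →
               diamondᴿ R f ⇓code T {suc m} zero (⟨ R ⟩ φ)
    diamond⇓ R φ d = pair⇓ (const⇓ 6) (pair⇓ (const⇓ 5) (pair⇓ (const⇓ _) d))

    -- The bridge from the opaque `code` to the `codeFO` that occurs in codes of instances.
    pairCode⇓ : ∀ {f g n} (φ : FO n) b → f ⇓code φ → g ⟦ xs ⟧⇓ b →
                pairᴿ f g ⟦ xs ⟧⇓ pair (codeFO φ) b
    pairCode⇓ φ b d e = pair⇓ d e

  box⇓ : ∀ {f m} R (φ : H) → f ⇓code T {2 + m} zero φ →
         boxᴿ R f ⇓code T {suc m} zero (¬ᴴ ⟨ R ⟩ ¬ᴴ φ)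
  box⇓ R φ d = not⇓ (diamond⇓ R (¬ᴴ φ) (not⇓ d))

-- Addresses of subprograms and the local laws of computation

-- The address of a subprogram, innermost index first; base relations are
-- addressed by nominals.
Path : Set
Path = Signature

-- V q relates an argument list to the value of the subprogram at q; it is
-- abstract for the same reason as code.
abstract

  V : Path → Rel
  V = codeSignature

  V-injective : ∀ q r → V q ≡ V r → q ≡ r
  V-injective = codeSignature-injective

-- In the intended models U reaches every point, G every point of the grid, Row the
-- points of the same row and Cn the other points of the same column.  The others
-- act on lists of numbers, n being identified with n ∷ []: head, tail, predecessor,
-- and the maps x + 1 ∷ l ↦ x ∷ l, l ↦ 0 ∷ l and x ∷ l ↦ x + 1 ∷ l.
Uᴿ Gᴿ Rowᴿ Cnᴿ Hdᴿ Tlᴿ Pᴿ Decᴿ Zcᴿ Incᴿ : Rel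
Uᴿ   = V (nom 0 ∷ [])
Gᴿ   = V (nom 1 ∷ [])
Rowᴿ = V (nom 2 ∷ [])
Cnᴿ  = V (nom 3 ∷ [])
Hdᴿ  = V (nom 4 ∷ [])
Tlᴿ  = V (nom 5 ∷ [])
Pᴿ   = V (nom 6 ∷ [])
Decᴿ = V (nom 7 ∷ [])
Zcᴿ  = V (nom 8 ∷ [])
Incᴿ = V (nom 9 ∷ [])

infixr 6 _⟹_

_⟹_ : H → H → H
φ ⟹ ψ = ¬ᴴ (φ ∧ᴴ ¬ᴴ ψ)

infix 9 □_

□_ : Rel → H → H
(□ R) φ = ¬ᴴ ⟨ R ⟩ ¬ᴴ φ

-- c and p are hidden, z marks the number zero.
c z p : H
c = nomᴴ 0
p = varᴴ 0
z = varᴴ 1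

nth : ℕ → H
nth zero    = ⟨ Hdᴿ ⟩ c
nth (suc i) = ⟨ Tlᴿ ⟩ nth i

_/_ : Path → ℕ → Path
q / i = rel i ∷ q

infixl 20 _/_

-- The case distinction is on recorded values of `F`: if none is nonzero, the search has to stop
-- here; if none is zero, it has to go on at the incremented list.
ok-search : Rel → Rel → H
ok-search F S = (⟨ S ⟩ c ∧ᴴ ¬ᴴ ⟨ F ⟩ ¬ᴴ z ⟹ ⟨ Hdᴿ ⟩ c)
             ∧ᴴ (⟨ S ⟩ c ∧ᴴ ¬ᴴ ⟨ F ⟩ z ⟹ ⟨ Incᴿ ⟩ ⟨ S ⟩ c)

-- `R` is the recursion, `F` its base case and `G` its step function. `S` leads from `suc k ∷ xs` to
-- `k ∷ y ∷ xs` with `y` the value at `k ∷ xs`; the third to fifth laws justify `k`, `y` and `xs` in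
-- turn.
ok-prec : (R F G S : Rel) → H
ok-prec R F G S =
     (⟨ R ⟩ c ∧ᴴ ¬ᴴ ⟨ Hdᴿ ⟩ ¬ᴴ z ⟹ ⟨ Tlᴿ ⟩ ⟨ F ⟩ c)
  ∧ᴴ (⟨ R ⟩ c ∧ᴴ ¬ᴴ ⟨ Hdᴿ ⟩ z ⟹ ⟨ S ⟩ ⟨ G ⟩ c)
  ∧ᴴ (⟨ S ⟩ ⟨ Hdᴿ ⟩ c ⟹ ⟨ Decᴿ ⟩ ⟨ Hdᴿ ⟩ c)
  ∧ᴴ (⟨ S ⟩ ⟨ Tlᴿ ⟩ ⟨ Hdᴿ ⟩ c ⟹ ⟨ Decᴿ ⟩ ⟨ R ⟩ c)
  ∧ᴴ (⟨ S ⟩ ⟨ Tlᴿ ⟩ ⟨ Tlᴿ ⟩ c ⟹ ⟨ Tlᴿ ⟩ c)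
  ∧ᴴ (⟨ S ⟩ c ⟹ ⟨ Uᴿ ⟩ c)

-- As c is arbitrary, ⟨ R ⟩ ⟨ S ⟩ c ⟹ ⟨ T ⟩ c says that R ∘ S is included in T.  Only
-- inclusions of recorded values into their justifications occur, never the
-- existence of a value, so that truncated computations are models.
ok  : ∀ {n} → Rec n → Path → H
oks : ∀ {m n} → Vec (Rec n) m → Path → H

ok zero        q = ¬ᴴ ⟨ V q ⟩ ¬ᴴ z
ok suc         q = (⟨ V q ⟩ ⟨ Pᴿ ⟩ c ⟹ ⟨ Hdᴿ ⟩ c) ∧ᴴ ¬ᴴ ⟨ V q ⟩ z
ok (proj i)    q = ⟨ V q ⟩ c ⟹ nth (toℕ i)
ok (comp f gs) q = (⟨ V q ⟩ c ⟹ ⟨ V (q / 1) ⟩ ⟨ V (q / 0) ⟩ c)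
                ∧ᴴ (⟨ V (q / 1) ⟩ c ⟹ ⟨ Uᴿ ⟩ c)
                ∧ᴴ ok f (q / 0) ∧ᴴ oks gs (q / 1)
ok (prec f g)  q = ok-prec (V q) (V (q / 0)) (V (q / 1)) (V (q / 2))
                ∧ᴴ ok f (q / 0) ∧ᴴ ok g (q / 1)
ok (min f)     q = (⟨ V q ⟩ c ⟹ ⟨ Zcᴿ ⟩ ⟨ V (q / 1) ⟩ c)
                ∧ᴴ ok-search (V (q / 0)) (V (q / 1)) ∧ᴴ ok f (q / 0)

oks []       q = ⊤ᴴ
oks (g ∷ gs) q = (⟨ V q ⟩ ⟨ Hdᴿ ⟩ c ⟹ ⟨ V (q / 0) ⟩ c)
              ∧ᴴ (⟨ V q ⟩ ⟨ Tlᴿ ⟩ c ⟹ ⟨ V (q / 1) ⟩ c)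
              ∧ᴴ ok g (q / 0) ∧ᴴ oks gs (q / 1)

ok-dec ok-zc ok-inc ok-base : H
ok-dec  = (⟨ Decᴿ ⟩ ⟨ Hdᴿ ⟩ c ⟹ ⟨ Hdᴿ ⟩ ⟨ Pᴿ ⟩ c)
       ∧ᴴ (⟨ Decᴿ ⟩ ⟨ Tlᴿ ⟩ c ⟹ ⟨ Tlᴿ ⟩ c)
       ∧ᴴ (⟨ Decᴿ ⟩ c ⟹ ⟨ Uᴿ ⟩ c)
ok-zc   = ¬ᴴ ⟨ Zcᴿ ⟩ ⟨ Hdᴿ ⟩ ¬ᴴ z
       ∧ᴴ (⟨ Zcᴿ ⟩ ⟨ Tlᴿ ⟩ c ⟹ c)
       ∧ᴴ (⟨ Zcᴿ ⟩ c ⟹ ⟨ Uᴿ ⟩ c)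
ok-inc  = ¬ᴴ ⟨ Incᴿ ⟩ ⟨ Hdᴿ ⟩ z
       ∧ᴴ (⟨ Incᴿ ⟩ ⟨ Hdᴿ ⟩ ⟨ Pᴿ ⟩ c ⟹ ⟨ Hdᴿ ⟩ c)
       ∧ᴴ (⟨ Incᴿ ⟩ ⟨ Tlᴿ ⟩ c ⟹ ⟨ Tlᴿ ⟩ c)
       ∧ᴴ (⟨ Incᴿ ⟩ c ⟹ ⟨ Uᴿ ⟩ c)
ok-base = ok-dec ∧ᴴ ok-zc ∧ᴴ ok-inc ∧ᴴ (⟨ Tlᴿ ⟩ c ⟹ ⟨ Uᴿ ⟩ c)

-- p is total on rows, injective on columns, and misses a column: the side of the
-- grid is Dedekind infinite.
infinite : H
infinite = (□ Gᴿ) (⟨ Rowᴿ ⟩ p)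
        ∧ᴴ (□ Gᴿ) (p ⟹ (□ Cnᴿ) (¬ᴴ p))
        ∧ᴴ ⟨ Gᴿ ⟩ (¬ᴴ p ∧ᴴ (□ Cnᴿ) (¬ᴴ p))

theory : Rec 2 → H
theory h = (⟨ Uᴿ ⟩ ⟨ Uᴿ ⟩ c ⟹ ⟨ Uᴿ ⟩ c)
        ∧ᴴ (□ Uᴿ) (ok-base ∧ᴴ ok h [])
        ∧ᴴ ¬ᴴ infinite

num : ℕ → H
num zero    = z
num (suc k) = ¬ᴴ z ∧ᴴ (□ Pᴿ) (num k)

-- The argument list is described by boxes, in accordance with the universal reading of numbers and
-- lists in `Num` and `Lst`.
root : ℕ → ℕ → H
root a b = ⟨ Uᴿ ⟩ (⟨ V [] ⟩ ¬ᴴ z ∧ᴴ (□ Hdᴿ) (num a) ∧ᴴ (□ Tlᴿ) ((□ Hdᴿ) (num b)))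

inst : H → ℕ → ℕ → H
inst A a b = ¬ᴴ (A ∧ᴴ root a b)

-- Soundness of the laws: a computation with value 0 refutes `theory` with `root`

reset : (M : Model) → W M → Model
reset M x = record
  { W = W M ; relᴹ = relᴹ M ; varᴹ = varᴹ M
  ; nomᴹ = λ { zero → x ; (suc a) → nomᴹ M (suc a) } }

module _ (M : Model) (x : W M) where

  reset-term : ∀ {n} (t : Term n) ρ → ¬ (nom 0 ∈ sigᵗ t) → ⟦ t ⟧ᵗ (reset M x) ρ ≡ ⟦ t ⟧ᵗ M ρ
  reset-term (var i)       ρ ∉ = refl
  reset-term (nom zero)    ρ ∉ = contradiction (here refl) ∉
  reset-term (nom (suc a)) ρ ∉ = refl

  reset-⇔ : ∀ {n} (φ : FO n) ρ → ¬ (nom 0 ∈ sig φ) →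
            (reset M x , ρ ⊨ᶠ φ) ⇔ (M , ρ ⊨ᶠ φ)
  reset-⇔ ⊤ᶠ ρ ∉ = mk⇔ id id
  reset-⇔ (s ≐ t) ρ ∉
    rewrite reset-term s ρ (∉ ∘ ∈-++⁺ˡ) | reset-term t ρ (∉ ∘ ∈-++⁺ʳ (sigᵗ s)) = mk⇔ id id
  reset-⇔ (varᶠ v t) ρ ∉ rewrite reset-term t ρ (∉ ∘ there) = mk⇔ id id
  reset-⇔ (relᶠ R s t) ρ ∉
    rewrite reset-term s ρ (∉ ∘ there ∘ ∈-++⁺ˡ)
          | reset-term t ρ (∉ ∘ there ∘ ∈-++⁺ʳ (sigᵗ s)) = mk⇔ id id
  reset-⇔ (¬ᶠ φ) ρ ∉ = mk⇔ (λ h k → h (from k)) (λ h k → h (to k))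
    where open Equivalence (reset-⇔ φ ρ ∉)
  reset-⇔ (φ ∧ᶠ ψ) ρ ∉ = mk⇔ (λ (h , k) → I.to h , J.to k) (λ (h , k) → I.from h , J.from k)
    where module I = Equivalence (reset-⇔ φ ρ (∉ ∘ ∈-++⁺ˡ))
          module J = Equivalence (reset-⇔ ψ ρ (∉ ∘ ∈-++⁺ʳ (sig φ)))
  reset-⇔ (∃ᶠ φ) ρ ∉ = mk⇔ (λ (v , h) → v , to (reset-⇔ φ (v ∷ ρ) ∉) h)
                           (λ (v , h) → v , from (reset-⇔ φ (v ∷ ρ) ∉) h)
    where open Equivalence

module Soundness (em : ExcludedMiddle 0ℓ) (M : Model) where

  stable : ∀ {P : Set} → ¬ ¬ P → P
  stable = decidable-stable em

  ⟹-elim : ∀ {P Q : Set} → ¬ (P × ¬ Q) → P → Q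
  ⟹-elim h x = stable λ y → h (x , y)

  -- Points without a predecessor represent every positive number, and lists without
  -- a head or tail represent many lists: soundness needs no functionality.
  Num : ℕ → W M → Set
  Num zero    x = varᴹ M 1 x
  Num (suc k) x = ¬ varᴹ M 1 x × (∀ y → relᴹ M Pᴿ x y → Num k y)

  Lst : ∀ {n} → Vec ℕ n → W M → Set
  Lst []       l = ⊤
  Lst (k ∷ ks) l = (∀ x → relᴹ M Hdᴿ l x → Num k x) × (∀ t → relᴹ M Tlᴿ l t → Lst ks t)

  module _ (w : W M) (closed : ∀ x → reset M x , w ⊨ᴴ ⟨ Uᴿ ⟩ ⟨ Uᴿ ⟩ c ⟹ ⟨ Uᴿ ⟩ c) where

    record Ok (φ : H) : Set where
      constructor mkOk
      field at : ∀ x y → relᴹ M Uᴿ w y → reset M x , y ⊨ᴴ φ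
    open Ok

    π₁ : ∀ {φ ψ} → Ok (φ ∧ᴴ ψ) → Ok φ
    π₁ h .at x y u = proj₁ (h .at x y u)

    π₂ : ∀ {φ ψ} → Ok (φ ∧ᴴ ψ) → Ok ψ
    π₂ h .at x y u = proj₂ (h .at x y u)

    -- Letting `c` denote the endpoint `x` of a path turns a law into an inclusion of relations: the
    -- path promised by the conclusion ends in the same `x`.
    ⊑ : ∀ {φ ψ} → Ok (φ ⟹ ψ) → ∀ {x y} → relᴹ M Uᴿ w y →
        reset M x , y ⊨ᴴ φ → reset M x , y ⊨ᴴ ψ
    ⊑ h u = ⟹-elim (h .at _ _ u)

    -- The law makes `x` a `Uᴿ`-successor of `y`, and `closed` composes the two steps from `w`. So
    -- the laws remain available along every path that `sound` follows.
    stepᵁ : ∀ {R} → Ok (⟨ R ⟩ c ⟹ ⟨ Uᴿ ⟩ c) → ∀ {y x} → relᴹ M Uᴿ w y → relᴹ M R y x →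
            relᴹ M Uᴿ w x
    stepᵁ h {y} {x} u r with ⊑ h {x} {y} u (x , r , refl)
    ... | _ , u′ , refl with ⟹-elim (closed x) (y , u , x , u′ , refl)
    ... | _ , u″ , refl = u″

    module _ (base : Ok ok-base) where

      dec-ok : Ok ok-dec
      dec-ok = π₁ base

      zc-ok : Ok ok-zc
      zc-ok = π₁ (π₂ base)

      inc-ok : Ok ok-inc
      inc-ok = π₁ (π₂ (π₂ base))

      tlᵁ : ∀ {y x} → relᴹ M Uᴿ w y → relᴹ M Tlᴿ y x → relᴹ M Uᴿ w x
      tlᵁ = stepᵁ (π₂ (π₂ (π₂ base)))

      decᵁ : ∀ {y x} → relᴹ M Uᴿ w y → relᴹ M Decᴿ y x → relᴹ M Uᴿ w x
      decᵁ = stepᵁ (π₂ (π₂ dec-ok))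

      dec-Lst : ∀ {n k l l′} {ks : Vec ℕ n} → relᴹ M Uᴿ w l → Lst (suc k ∷ ks) l →
                relᴹ M Decᴿ l l′ → Lst (k ∷ ks) l′
      dec-Lst {l = l} u (hd , tl) d =
          (λ x r → case₁ (⊑ (π₁ dec-ok) {x} u (_ , d , _ , r , refl)))
        , (λ t r → case₂ (⊑ (π₁ (π₂ dec-ok)) {t} u (_ , d , _ , r , refl)))
        where
        case₁ : ∀ {x} → reset M x , l ⊨ᴴ ⟨ Hdᴿ ⟩ ⟨ Pᴿ ⟩ c → _
        case₁ (_ , r , _ , r′ , refl) = proj₂ (hd _ r) _ r′
        case₂ : ∀ {t} → reset M t , l ⊨ᴴ ⟨ Tlᴿ ⟩ c → _
        case₂ (_ , r , refl) = tl _ r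

      zcᵁ : ∀ {y x} → relᴹ M Uᴿ w y → relᴹ M Zcᴿ y x → relᴹ M Uᴿ w x
      zcᵁ = stepᵁ (π₂ (π₂ zc-ok))

      zc-Lst : ∀ {n l l′} {ks : Vec ℕ n} → relᴹ M Uᴿ w l → Lst ks l →
               relᴹ M Zcᴿ l l′ → Lst (0 ∷ ks) l′
      zc-Lst {l = l} {ks = ks} u hl d =
          (λ x r → stable λ ¬z → proj₁ (zc-ok .at x _ u) (_ , d , x , r , ¬z))
        , λ t r → subst (Lst ks) (⊑ (π₁ (π₂ zc-ok)) u (_ , d , t , r , refl)) hl

      incᵁ : ∀ {y x} → relᴹ M Uᴿ w y → relᴹ M Incᴿ y x → relᴹ M Uᴿ w x
      incᵁ = stepᵁ (π₂ (π₂ (π₂ inc-ok)))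

      inc-Lst : ∀ {n k l l′} {ks : Vec ℕ n} → relᴹ M Uᴿ w l → Lst (k ∷ ks) l →
                relᴹ M Incᴿ l l′ → Lst (suc k ∷ ks) l′
      inc-Lst {l = l} u (hd , tl) d =
          (λ x r → (λ hz → proj₁ (inc-ok .at x l u) (_ , d , x , r , hz))
                 , λ y s → case₁ (⊑ (π₁ (π₂ inc-ok)) {y} u
                                    (_ , d , x , r , y , s , refl)))
        , (λ t r → case₂ (⊑ (π₁ (π₂ (π₂ inc-ok))) {t} u
                            (_ , d , t , r , refl)))
        where
        case₁ : ∀ {x} → reset M x , l ⊨ᴴ ⟨ Hdᴿ ⟩ c → _
        case₁ (_ , r , refl) = hd _ r
        case₂ : ∀ {t} → reset M t , l ⊨ᴴ ⟨ Tlᴿ ⟩ c → _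
        case₂ (_ , r , refl) = tl _ r

      nth-Num : ∀ {n} (i : Fin n) {ks l x} → Lst ks l → reset M x , l ⊨ᴴ nth (toℕ i) →
                Num (lookup ks i) x
      nth-Num zero    {k ∷ ks} (hd , tl) (_ , r , refl) = hd _ r
      nth-Num (suc i) {k ∷ ks} (hd , tl) (_ , r , h)    = nth-Num i (tl _ r) h

      -- Induction on the derivation. The law at `q` justifies a recorded value by recorded values
      -- of the parts, and the induction hypotheses determine those.
      sound : ∀ {n} {f : Rec n} {ks v} → f ⟦ ks ⟧⇓ v → ∀ q → Ok (ok f q) →
              ∀ {l} → relᴹ M Uᴿ w l → Lst ks l → ∀ {x} → relᴹ M (V q) l x → Num v x
      sounds : ∀ {m n} {gs : Vec (Rec n) m} {ks vs} →
               (∀ i q → Ok (ok (lookup gs i) q) →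
                  ∀ {l} → relᴹ M Uᴿ w l → Lst ks l → ∀ {x} → relᴹ M (V q) l x →
                  Num (lookup vs i) x) →
               ∀ q → Ok (oks gs q) → ∀ {l} → relᴹ M Uᴿ w l → Lst ks l →
               ∀ {l′} → relᴹ M (V q) l l′ → Lst vs l′

      sound ⇓zero q h u hl {x} r = stable λ ¬z → h .at x _ u (x , r , ¬z)
      sound ⇓suc q h {l} u (hd , _) {x} r =
          (λ hz → proj₂ (h .at x _ u) (x , r , hz))
        , (λ y s → case (⊑ (π₁ h) {y} u (x , r , y , s , refl)))
        where
        case : ∀ {y} → reset M y , l ⊨ᴴ ⟨ Hdᴿ ⟩ c → _
        case (_ , s , refl) = hd _ s
      sound (⇓proj i) q h u hl {x} r = nth-Num i hl (⊑ h {x} u (x , r , refl))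
      sound (⇓comp ys ds d) q h {l} u hl {x} r
        with ⊑ (π₁ h) {x} u (x , r , refl)
      ... | l′ , r₁ , _ , r₀ , refl =
        sound d (q / 0) (π₁ (π₂ (π₂ h)))
          (stepᵁ (π₁ (π₂ h)) u r₁)
          (sounds (λ i → sound (ds i)) (q / 1) (π₂ (π₂ (π₂ h))) u hl r₁) r₀
      sound (⇓prec₀ d) q h {l} u (hd , tl) {x} r
        with ⊑ (π₁ (π₁ h)) {x} u
               ((x , r , refl) , λ (e , s , ¬z) → ¬z (hd e s))
      ... | t , r₁ , _ , r₀ , refl =
        sound d (q / 0) (π₁ (π₂ h)) (tlᵁ u r₁) (tl t r₁) r₀
      sound (⇓precₛ {xs = xs} {k = k} {y = y} d e) q h {l} u hl@(hd , tl) {x} r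
        with ⊑ (π₁ (π₂ (π₁ h))) {x} u
               ((x , r , refl) , λ (e , s , hz) → proj₁ (hd e s) hz)
      ... | l′ , r₂ , _ , r₁ , refl =
        sound e (q / 1) (π₂ (π₂ h))
          (stepᵁ (π₂ (π₂ (π₂ (π₂ (π₂ (π₁ h)))))) u r₂)
          ( (λ a s → case₁ (⊑ (π₁ (π₂ (π₂ (π₁ h)))) {a} u
                              (l′ , r₂ , a , s , refl)))
          , (λ t s →
               (λ a s′ → case₂ (⊑ (π₁ (π₂ (π₂ (π₂ (π₁ h))))) {a} u
                                  (l′ , r₂ , t , s , a , s′ , refl)))
             , (λ a s′ → case₃ (⊑ (π₁ (π₂ (π₂ (π₂ (π₂ (π₁ h)))))) {a} u
                                  (l′ , r₂ , t , s , a , s′ , refl))))) r₁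
        where
        case₁ : ∀ {a} → reset M a , l ⊨ᴴ ⟨ Decᴿ ⟩ ⟨ Hdᴿ ⟩ c → Num k a
        case₁ (_ , s , _ , s′ , refl) = proj₁ (dec-Lst {k = k} {ks = xs} u hl s) _ s′
        case₂ : ∀ {a} → reset M a , l ⊨ᴴ ⟨ Decᴿ ⟩ ⟨ V q ⟩ c → Num y a
        -- The previous value belongs to the same program at the decremented list, so the address
        -- stays `q` while the derivation shrinks to `d`.
        case₂ (_ , s , _ , s′ , refl) = sound d q h (decᵁ u s) (dec-Lst {k = k} {ks = xs} u hl s) s′
        case₃ : ∀ {a} → reset M a , l ⊨ᴴ ⟨ Tlᴿ ⟩ c → Lst xs a
        case₃ (_ , s , refl) = tl _ s
      sound {f = min f} {ks} {v} (⇓min d lt) q h {l} u hl {x} r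
        with ⊑ (π₁ h) {x} u (x , r , refl)
      ... | l′ , r₁ , _ , r₀ , refl = search v 0 (+-identityʳ v) (zcᵁ u r₁) (zc-Lst u hl r₁) r₀
        where
        h₀ : Ok (ok f (q / 0))
        h₀ = π₂ (π₂ h)
        -- Countdown: `k` is the current candidate and `j` its distance to the least zero `v`.
        search : ∀ j k → j + k ≡ v → ∀ {m} → relᴹ M Uᴿ w m → Lst (k ∷ ks) m →
                 ∀ {y} → relᴹ M (V (q / 1)) m y → Num v y
        search zero k refl {m} u hm {y} r
          with ⊑ (π₁ (π₁ (π₂ h))) {y} u
                 ((y , r , refl) , λ (e , s , ¬z) → ¬z (sound d (q / 0) h₀ u hm s))
        ... | _ , s , refl = proj₁ hm _ s
        search (suc j) k eq {m} u hm {y} r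
          with ⊑ (π₂ (π₁ (π₂ h))) {y} u
                 ((y , r , refl) , λ (e , s , hz) →
                   proj₁ (sound (proj₂ (lt (subst (k <_) eq (s≤s (m≤n+m k j))))) (q / 0) h₀ u hm s) hz)
        ... | _ , s , _ , s′ , refl =
          search j (suc k) (trans (+-suc j k) eq) (incᵁ u s) (inc-Lst {k = k} {ks = ks} u hm s) s′

      sounds {gs = []}     {vs = []}     ds q h u hl r = tt
      sounds {gs = g ∷ gs} {vs = v ∷ vs} ds q h {l} u hl {l′} r =
          (λ x s → case₁ (⊑ (π₁ h) {x} u (l′ , r , x , s , refl)))
        , (λ t s → case₂ (⊑ (π₁ (π₂ h)) {t} u (l′ , r , t , s , refl)))
        where
        case₁ : ∀ {x} → reset M x , l ⊨ᴴ ⟨ V (q / 0) ⟩ c → Num v x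
        case₁ (_ , s , refl) = ds zero (q / 0) (π₁ (π₂ (π₂ h))) u hl s
        case₂ : ∀ {t} → reset M t , l ⊨ᴴ ⟨ V (q / 1) ⟩ c → Lst vs t
        case₂ (_ , s , refl) = sounds (λ i → ds (suc i)) (q / 1) (π₂ (π₂ (π₂ h))) u hl s

  num-Num : ∀ k {x y} → reset M x , y ⊨ᴴ num k → Num k y
  num-Num zero    h       = h
  num-Num (suc k) (h , i) = h , λ y r → num-Num k (stable λ j → i (y , r , j))

  -- At the address of the whole program, `sound` forces the value recorded by `root` to be zero.
  unsatisfiable : ∀ {h a b} → h ⟦ a ∷ b ∷ [] ⟧⇓ 0 → ∀ w →
                  ¬ (∀ x → reset M x , w ⊨ᴴ theory h ∧ᴴ root a b)
  -- The formula `root` does not mention `c`, so any reset yields its witnesses; `w` is an arbitrary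
  -- choice.
  unsatisfiable {h} {a} {b} d w hyp with proj₂ (hyp w)
  ... | l , u , (x , r , ¬z) , hd , tl =
    ¬z (sound w (λ x → proj₁ (proj₁ (hyp x)))
              (mkOk λ x y u → proj₁ (thy x y u)) d [] (mkOk λ x y u → proj₂ (thy x y u)) u
              ( (λ e s → num-Num a (stable λ j → hd (e , s , j)))
              , (λ t s → (λ e s′ → num-Num b (stable λ j →
                                     tl (t , s , λ k → k (e , s′ , j))))
                       , (λ _ _ → tt)))
              r)
    where
    thy : ∀ x y → relᴹ M Uᴿ w y → reset M x , y ⊨ᴴ ok-base ∧ᴴ ok h []
    thy x y u = stable λ k → proj₁ (proj₂ (proj₁ (hyp x))) (y , u , k)

-- Bounded evaluation

data Thing : Set where
  U G Row Cn Hd Tl P Decr Zc Incr none : Thing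
  fun    : ∀ {n} → Rec n → Thing
  funs   : ∀ {m n} → Vec (Rec n) m → Thing
  search : ∀ {n} → Rec (suc n) → Thing
  step   : ∀ {n} → Rec n → Rec (2 + n) → Thing

-- The numbering follows the nominals in `Uᴿ` to `Incᴿ`.
base : ℕ → Thing
base 0 = U
base 1 = G
base 2 = Row
base 3 = Cn
base 4 = Hd
base 5 = Tl
base 6 = P
base 7 = Decr
base 8 = Zc
base 9 = Incr
base _ = none

child : ℕ → Thing → Thing
child 0 (fun (comp f gs)) = fun f
child 1 (fun (comp f gs)) = funs gs
child 0 (fun (prec f g))  = fun f
child 1 (fun (prec f g))  = fun g
child 2 (fun (prec f g))  = step f g
child 0 (fun (min f))     = fun f
child 1 (fun (min f))     = search f
child 0 (funs (g ∷ gs))   = fun g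
child 1 (funs (g ∷ gs))   = funs gs
child _ _                 = none

thing : Rec 2 → Path → Thing
thing h []          = fun h
thing h (nom i ∷ q) = base i
thing h (rel j ∷ q) = child j (thing h q)
thing h (var _ ∷ q) = none

-- Bounding length and entries alike leaves only finitely many lists.
Bounded : ℕ → List ℕ → Set
Bounded B l = length l ≤ B × All (_≤ B) l

data Nth : List ℕ → ℕ → ℕ → Set where
  here  : ∀ {x xs} → Nth (x ∷ xs) 0 x
  there : ∀ {x xs i y} → Nth xs i y → Nth (x ∷ xs) (suc i) y

-- Evaluation in which every list that is passed on is bounded by B.
data Ev (B : ℕ) : Thing → List ℕ → List ℕ → Set where
  hd    : ∀ {x xs} → Ev B Hd (x ∷ xs) (x ∷ [])
  tl    : ∀ {x xs} → Ev B Tl (x ∷ xs) xs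
  pred  : ∀ {x} → Ev B P (suc x ∷ []) (x ∷ [])
  dec   : ∀ {x xs} → Ev B Decr (suc x ∷ xs) (x ∷ xs)
  zc    : ∀ {xs} → Ev B Zc xs (0 ∷ xs)
  inc   : ∀ {x xs} → Ev B Incr (x ∷ xs) (suc x ∷ xs)
  zero  : ∀ {n xs} → Ev B (fun (zero {n})) xs (0 ∷ [])
  suc   : ∀ {x xs} → Ev B (fun suc) (x ∷ xs) (suc x ∷ [])
  proj  : ∀ {n} {i : Fin n} {xs x} → Nth xs (toℕ i) x → Ev B (fun (proj i)) xs (x ∷ [])
  comp  : ∀ {m n} {f : Rec m} {gs : Vec (Rec n) m} {xs ys v} →
          Ev B (funs gs) xs ys → Bounded B ys → Ev B (fun f) ys v →
          Ev B (fun (comp f gs)) xs v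
  []    : ∀ {n xs} → Ev B (funs {n = n} []) xs []
  _∷_   : ∀ {m n} {g : Rec n} {gs : Vec (Rec n) m} {xs y ys} →
          Ev B (fun g) xs (y ∷ []) → Ev B (funs gs) xs ys → Ev B (funs (g ∷ gs)) xs (y ∷ ys)
  prec₀ : ∀ {n} {f : Rec n} {g xs v} → Ev B (fun f) xs v → Ev B (fun (prec f g)) (0 ∷ xs) v
  precₛ : ∀ {n} {f : Rec n} {g k xs ys v} →
          Ev B (step f g) (suc k ∷ xs) ys → Bounded B ys → Ev B (fun g) ys v →
          Ev B (fun (prec f g)) (suc k ∷ xs) v
  step  : ∀ {n} {f : Rec n} {g k xs y} → Ev B (fun (prec f g)) (k ∷ xs) (y ∷ []) →
          Ev B (step f g) (suc k ∷ xs) (k ∷ y ∷ xs)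
  min   : ∀ {n} {f : Rec (suc n)} {xs v} →
          Bounded B (0 ∷ xs) → Ev B (search f) (0 ∷ xs) v → Ev B (fun (min f)) xs v
  stop  : ∀ {n} {f : Rec (suc n)} {y xs} → Ev B (fun f) (y ∷ xs) (0 ∷ []) →
          Ev B (search f) (y ∷ xs) (y ∷ [])
  next  : ∀ {n} {f : Rec (suc n)} {y xs u v} →
          Ev B (fun f) (y ∷ xs) (suc u ∷ []) → Bounded B (suc u ∷ []) →
          Bounded B (suc y ∷ xs) → Ev B (search f) (suc y ∷ xs) v →
          Ev B (search f) (y ∷ xs) v

bounded-mono : ∀ {B C l} → B ≤ C → Bounded B l → Bounded C l
bounded-mono B≤C (p , q) = ≤-trans p B≤C , All.map (λ r → ≤-trans r B≤C) q

-- The successor takes care of the length, the maximum of the entries.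
bound : List ℕ → ℕ
bound []      = 0
bound (x ∷ l) = suc (x ⊔ bound l)

bounded : ∀ l → Bounded (bound l) l
bounded []      = z≤n , []
bounded (x ∷ l) with bounded l
... | p , q = s≤s (≤-trans p (m≤n⊔m x _))
            , m≤n⇒m≤1+n (m≤m⊔n x _)
            ∷ All.map (λ r → ≤-trans r (m≤n⇒m≤1+n (m≤n⊔m x _))) q

ev-mono : ∀ {B C} → B ≤ C → ∀ {t l l′} → Ev B t l l′ → Ev C t l l′
ev-mono le hd            = hd
ev-mono le tl            = tl
ev-mono le pred          = pred
ev-mono le dec           = dec
ev-mono le zc            = zc
ev-mono le inc           = inc
ev-mono le zero          = zero
ev-mono le suc           = suc
ev-mono le (proj n)      = proj n
ev-mono le (comp d b e)  = comp (ev-mono le d) (bounded-mono le b) (ev-mono le e)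
ev-mono le []            = []
ev-mono le (d ∷ e)       = ev-mono le d ∷ ev-mono le e
ev-mono le (prec₀ d)     = prec₀ (ev-mono le d)
ev-mono le (precₛ d b e) = precₛ (ev-mono le d) (bounded-mono le b) (ev-mono le e)
ev-mono le (step d)      = step (ev-mono le d)
ev-mono le (min b d)     = min (bounded-mono le b) (ev-mono le d)
ev-mono le (stop d)      = stop (ev-mono le d)
ev-mono le (next d b b′ e) =
  next (ev-mono le d) (bounded-mono le b) (bounded-mono le b′) (ev-mono le e)

-- Upward closure allows finitely many requirements to be met by a single bound, the maximum.
Eventually : (ℕ → Set) → Set
Eventually Q = ∃ λ B → ∀ {C} → B ≤ C → Q C

infixr 5 _&_
_&_ : ∀ {Q R} → Eventually Q → Eventually R → Eventually (λ B → Q B × R B)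
(B , f) & (C , g) = B ⊔ C , λ le → f (≤-trans (m≤m⊔n B C) le) , g (≤-trans (m≤n⊔m B C) le)

infixl 4 _⟨$⟩_
_⟨$⟩_ : ∀ {Q R : ℕ → Set} → (∀ {B} → Q B → R B) → Eventually Q → Eventually R
f ⟨$⟩ (B , g) = B , λ le → f (g le)

always-bounded : ∀ l → Eventually (λ B → Bounded B l)
always-bounded l = bound l , λ le → bounded-mono le (bounded l)

Total : Thing → List ℕ → List ℕ → Set
Total t l l′ = Eventually λ B → Ev B t l l′

nth-lookup : ∀ {n} (xs : Vec ℕ n) i → Nth (toList xs) (toℕ i) (lookup xs i)
nth-lookup (x ∷ xs) zero    = here
nth-lookup (x ∷ xs) (suc i) = there (nth-lookup xs i)

totals : ∀ {m n} (gs : Vec (Rec n) m) ys {l} →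
         (∀ i → Total (fun (lookup gs i)) l (lookup ys i ∷ [])) → Total (funs gs) l (toList ys)
totals []       []       ts = 0 , λ _ → []
totals (g ∷ gs) (y ∷ ys) ts = (λ (d , e) → d ∷ e) ⟨$⟩ (ts zero & totals gs ys (λ i → ts (suc i)))

-- A derivation is finite, so only finitely many lists are passed on in it and one bound covers them
-- all.
total : ∀ {n} {f : Rec n} {xs v} → f ⟦ xs ⟧⇓ v → Total (fun f) (toList xs) (v ∷ [])
total ⇓zero = 0 , λ _ → zero
total ⇓suc  = 0 , λ _ → suc
total (⇓proj {xs = xs} i) = 0 , λ _ → proj (nth-lookup xs i)
total (⇓comp {gs = gs} ys ds d) =
  (λ (d , b , e) → comp d b e) ⟨$⟩
    (totals gs ys (λ i → total (ds i)) & always-bounded (toList ys) & total d)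
total (⇓prec₀ d) = prec₀ ⟨$⟩ total d
total (⇓precₛ {xs = xs} {k} {y} d e) =
  (λ (d , b , e) → precₛ (step d) b e) ⟨$⟩
    (total d & always-bounded (k ∷ y ∷ toList xs) & total e)
total {f = min f} {xs} {v} (⇓min d lt) =
  (λ (b , d) → min b d) ⟨$⟩ (always-bounded (0 ∷ toList xs) & go v 0 (+-identityʳ v))
  where
  go : ∀ j k → j + k ≡ v → Total (search f) (k ∷ toList xs) (v ∷ [])
  go zero    k refl = stop ⟨$⟩ total d
  go (suc j) k eq with lt (subst (k <_) eq (s≤s (m≤n+m k j)))
                     | total (proj₂ (lt (subst (k <_) eq (s≤s (m≤n+m k j)))))
  ... | u , _ | t = (λ (d , b , b′ , e) → next d b b′ e) ⟨$⟩
    (t & always-bounded _ & always-bounded (suc k ∷ toList xs) & go j (suc k) (trans (+-suc j k) eq))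

-- The standard models: a bounded computation beside a grid

data Pt (D : Set) : Set where
  top : Pt D
  pt  : List ℕ → Pt D
  gr  : D → D → Pt D

module Std (h : Rec 2) (B : ℕ) where

  In : ∀ {D} → Pt D → Set
  In top      = ⊤
  In (pt l)   = Bounded B l
  In (gr _ _) = ⊤

  data Sem {D : Set} : Thing → Pt D → Pt D → Set where
    all : ∀ {x y} → In y → Sem U x y
    grd : ∀ {a b} → Sem G top (gr a b)
    row : ∀ {a b b′} → Sem Row (gr a b) (gr a b′)
    col : ∀ {a a′ b} → a ≢ a′ → Sem Cn (gr a b) (gr a′ b)
    ev  : ∀ {t l l′} → Bounded B l′ → Ev B t l l′ → Sem t (pt l) (pt l′)

  -- Lists beyond the bound stay in the domain, but no edge enters them. A hybrid formula at `top`
  -- therefore sees only the points in `In`, finitely many if `D` is finite.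
  sem-In : ∀ {D t} {x y : Pt D} → Sem t x y → In y
  sem-In (all i)  = i
  sem-In grd      = tt
  sem-In row      = tt
  sem-In (col _)  = tt
  sem-In (ev b _) = b

  varˢ : ∀ {D} → (Pt D → Set) → ℕ → Pt D → Set
  varˢ Q 0             x = Q x
  varˢ Q 1             x = x ≡ pt (0 ∷ [])
  varˢ Q (suc (suc _)) x = ⊥

  -- A relation symbol is interpreted through the address that it encodes, which is unique by
  -- `V-injective`; other symbols denote the empty relation.
  std : (D : Set) → (Pt D → Set) → (Nom → Pt D) → Model
  std D Q ν = record
    { W    = Pt D
    ; relᴹ = λ R x y → ∃ λ q → V q ≡ R × Sem (thing h q) x y
    ; varᴹ = varˢ Q
    ; nomᴹ = ν }

  module Verify (D : Set) (Q : Pt D → Set) (ν : Nom → Pt D) where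

    M : Model
    M = std D Q ν

    in′ : ∀ {q t x y} → thing h q ≡ t → Sem t x y → relᴹ M (V q) x y
    in′ {q} refl s = q , refl , s

    out : ∀ {q t x y} → thing h q ≡ t → relᴹ M (V q) x y → Sem t x y
    out {q} refl (q′ , e , s) with V-injective q′ q e
    ... | refl = s

    head-bounded : ∀ {x xs} → Bounded B (x ∷ xs) → Bounded B (x ∷ [])
    head-bounded (p , q ∷ _) = ≤-trans (s≤s z≤n) p , q ∷ []

    zero-bounded : ∀ {x xs} → Bounded B (x ∷ xs) → Bounded B (0 ∷ [])
    zero-bounded (p , _) = ≤-trans (s≤s z≤n) p , z≤n ∷ []

    tail-bounded : ∀ {x xs} → Bounded B (x ∷ xs) → Bounded B xs
    tail-bounded (p , _ ∷ q) = <⇒≤ p , q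

    dec-bounded : ∀ {x xs} → Bounded B (suc x ∷ xs) → Bounded B (x ∷ xs)
    dec-bounded (p , q ∷ r) = p , <⇒≤ q ∷ r

    -- Every edge ends in `In`, and `Uᴿ` leads from anywhere to all of `In`.
    to-U : ∀ R {x} → M , x ⊨ᴴ ⟨ R ⟩ c ⟹ ⟨ Uᴿ ⟩ c
    to-U R ((y , (q , _ , s) , e) , k) = k (y , in′ {nom 0 ∷ []} refl (all (sem-In s)) , e)

    nth⊨ : ∀ {xs i v} → Bounded B xs → Nth xs i v → pt (v ∷ []) ≡ ν 0 → M , pt xs ⊨ᴴ nth i
    nth⊨ b here e      = _ , in′ {nom 4 ∷ []} refl (ev (head-bounded b) hd) , e
    nth⊨ b (there n) e =
      _ , in′ {nom 5 ∷ []} refl (ev (tail-bounded b) tl) , nth⊨ (tail-bounded b) n e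

    dec⊨ : ∀ {x} → In x → M , x ⊨ᴴ ok-dec
    dec⊨ ix =
        (λ ((_ , r , _ , r′ , e) , k) → case₁ ix (out {nom 7 ∷ []} refl r) (out {nom 4 ∷ []} refl r′) e k)
      , (λ ((_ , r , _ , r′ , e) , k) → case₂ (out {nom 7 ∷ []} refl r) (out {nom 5 ∷ []} refl r′) e k)
      , to-U Decᴿ
      where
      case₁ : ∀ {x y y′} → In x → Sem Decr x y → Sem Hd y y′ → y′ ≡ ν 0 → ¬ ¬ (M , x ⊨ᴴ ⟨ Hdᴿ ⟩ ⟨ Pᴿ ⟩ c)
      case₁ ix (ev b dec) (ev b′ hd) e k =
        k (_ , in′ {nom 4 ∷ []} refl (ev (head-bounded ix) hd)
          , _ , in′ {nom 6 ∷ []} refl (ev b′ pred) , e)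
      case₂ : ∀ {x y y′} → Sem Decr x y → Sem Tl y y′ → y′ ≡ ν 0 → ¬ ¬ (M , x ⊨ᴴ ⟨ Tlᴿ ⟩ c)
      case₂ (ev b dec) (ev b′ tl) e k = k (_ , in′ {nom 5 ∷ []} refl (ev b′ tl) , e)

    zc⊨ : ∀ {x} → M , x ⊨ᴴ ok-zc
    zc⊨ = (λ (_ , r , _ , r′ , k) → case₁ (out {nom 8 ∷ []} refl r) (out {nom 4 ∷ []} refl r′) k)
        , (λ ((_ , r , _ , r′ , e) , k) → k (case₂ (out {nom 8 ∷ []} refl r) (out {nom 5 ∷ []} refl r′) e))
        , to-U Zcᴿ
      where
      case₁ : ∀ {x y y′} → Sem Zc x y → Sem Hd y y′ → ¬ ¬ (y′ ≡ pt (0 ∷ []))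
      case₁ (ev b zc) (ev b′ hd) k = k refl
      case₂ : ∀ {x y y′} → Sem Zc x y → Sem Tl y y′ → y′ ≡ ν 0 → x ≡ ν 0
      case₂ (ev b zc) (ev b′ tl) e = e

    inc⊨ : ∀ {x} → In x → M , x ⊨ᴴ ok-inc
    inc⊨ ix =
        (λ (_ , r , _ , r′ , e) → case₀ (out {nom 9 ∷ []} refl r) (out {nom 4 ∷ []} refl r′) e)
      , (λ ((_ , r , _ , r′ , _ , r″ , e) , k) → case₁ ix (out {nom 9 ∷ []} refl r) (out {nom 4 ∷ []} refl r′)
                                                    (out {nom 6 ∷ []} refl r″) e k)
      , (λ ((_ , r , _ , r′ , e) , k) → case₂ (out {nom 9 ∷ []} refl r) (out {nom 5 ∷ []} refl r′) e k)
      , to-U Incᴿ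
      where
      case₀ : ∀ {x y y′} → Sem Incr x y → Sem Hd y y′ → y′ ≢ pt (0 ∷ [])
      case₀ (ev b inc) (ev b′ hd) ()
      case₁ : ∀ {x y y′ y″} → In x → Sem Incr x y → Sem Hd y y′ → Sem P y′ y″ → y″ ≡ ν 0 →
              ¬ ¬ (M , x ⊨ᴴ ⟨ Hdᴿ ⟩ c)
      case₁ ix (ev b inc) (ev b′ hd) (ev b″ pred) e k =
        k (_ , in′ {nom 4 ∷ []} refl (ev (head-bounded ix) hd) , e)
      case₂ : ∀ {x y y′} → Sem Incr x y → Sem Tl y y′ → y′ ≡ ν 0 → ¬ ¬ (M , x ⊨ᴴ ⟨ Tlᴿ ⟩ c)
      case₂ (ev b inc) (ev b′ tl) e k = k (_ , in′ {nom 5 ∷ []} refl (ev b′ tl) , e)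

    base⊨ : ∀ {x} → In x → M , x ⊨ᴴ ok-base
    base⊨ ix = dec⊨ ix , zc⊨ , inc⊨ ix , to-U Tlᴿ

    search⊨ : ∀ {n} (f : Rec (suc n)) q r → thing h q ≡ fun f → thing h r ≡ search f →
              ∀ {x} → In x → M , x ⊨ᴴ ok-search (V q) (V r)
    search⊨ f q r eq er ix =
        (λ (((_ , s , e) , g) , k) → case₁ ix (out {r} er s) e g k)
      , (λ (((_ , s , e) , g) , k) → case₂ ix (out {r} er s) e g k)
      where
      case₁ : ∀ {x y} → In x → Sem (search f) x y → y ≡ ν 0 →
              M , x ⊨ᴴ ¬ᴴ ⟨ V q ⟩ ¬ᴴ z → ¬ ¬ (M , x ⊨ᴴ ⟨ Hdᴿ ⟩ c)
      case₁ ix (ev b (stop d)) e g k = k (_ , in′ {nom 4 ∷ []} refl (ev b hd) , e)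
      -- The bound kept in `next` for the nonzero value makes it a recorded one, which contradicts
      -- the premise of the stopping law.
      case₁ ix (ev b (next d b′ _ _)) e g k = g (_ , in′ {q} eq (ev b′ d) , λ ())
      case₂ : ∀ {x y} → In x → Sem (search f) x y → y ≡ ν 0 →
              M , x ⊨ᴴ ¬ᴴ ⟨ V q ⟩ z → ¬ ¬ (M , x ⊨ᴴ ⟨ Incᴿ ⟩ ⟨ V r ⟩ c)
      -- The value zero is recorded because any bound that admits a nonempty list admits `0 ∷ []`.
      case₂ ix (ev b (stop d)) e g k = g (_ , in′ {q} eq (ev (zero-bounded ix) d) , refl)
      case₂ ix (ev b (next d _ b′ d′)) e g k =
        k (_ , in′ {nom 9 ∷ []} refl (ev b′ inc) , _ , in′ {r} er (ev b d′) , e)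

    prec⊨ : ∀ {n} (f : Rec n) g q → thing h q ≡ fun (prec f g) →
            ∀ {x} → In x → M , x ⊨ᴴ ok-prec (V q) (V (q / 0)) (V (q / 1)) (V (q / 2))
    prec⊨ f g q eq ix =
        (λ (((_ , s , e) , g) , k) → case₁ ix (out {q} eq s) e g k)
      , (λ (((_ , s , e) , g) , k) → case₂ ix (out {q} eq s) e g k)
      , (λ ((_ , s , _ , s′ , e) , k) → case₃ ix (out {q / 2} eq₂ s) (out {nom 4 ∷ []} refl s′) e k)
      , (λ ((_ , s , _ , s′ , _ , s″ , e) , k) →
           case₄ ix (out {q / 2} eq₂ s) (out {nom 5 ∷ []} refl s′) (out {nom 4 ∷ []} refl s″) e k)
      , (λ ((_ , s , _ , s′ , _ , s″ , e) , k) →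
           case₅ ix (out {q / 2} eq₂ s) (out {nom 5 ∷ []} refl s′) (out {nom 5 ∷ []} refl s″) e k)
      , to-U (V (q / 2))
      where
      eq₂ : thing h (q / 2) ≡ step f g
      eq₂ = cong (child 2) eq
      case₁ : ∀ {x y} → In x → Sem (fun (prec f g)) x y → y ≡ ν 0 →
              M , x ⊨ᴴ ¬ᴴ ⟨ Hdᴿ ⟩ ¬ᴴ z → ¬ ¬ (M , x ⊨ᴴ ⟨ Tlᴿ ⟩ ⟨ V (q / 0) ⟩ c)
      case₁ ix (ev b (prec₀ d)) e g k =
        k (_ , in′ {nom 5 ∷ []} refl (ev (tail-bounded ix) tl)
          , _ , in′ {q / 0} (cong (child 0) eq) (ev b d) , e)
      case₁ ix (ev b (precₛ _ _ _)) e g k =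
        g (_ , in′ {nom 4 ∷ []} refl (ev (head-bounded ix) hd) , λ ())
      case₂ : ∀ {x y} → In x → Sem (fun (prec f g)) x y → y ≡ ν 0 →
              M , x ⊨ᴴ ¬ᴴ ⟨ Hdᴿ ⟩ z → ¬ ¬ (M , x ⊨ᴴ ⟨ V (q / 2) ⟩ ⟨ V (q / 1) ⟩ c)
      case₂ ix (ev b (prec₀ d)) e g k =
        g (_ , in′ {nom 4 ∷ []} refl (ev (head-bounded ix) hd) , refl)
      case₂ ix (ev b (precₛ d b′ d′)) e g k =
        k (_ , in′ {q / 2} eq₂ (ev b′ d) , _ , in′ {q / 1} (cong (child 1) eq) (ev b d′) , e)
      case₃ : ∀ {x y y′} → In x → Sem (step f g) x y → Sem Hd y y′ → y′ ≡ ν 0 →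
              ¬ ¬ (M , x ⊨ᴴ ⟨ Decᴿ ⟩ ⟨ Hdᴿ ⟩ c)
      case₃ ix (ev b (step d)) (ev b′ hd) e k =
        k (_ , in′ {nom 7 ∷ []} refl (ev (dec-bounded ix) dec)
          , _ , in′ {nom 4 ∷ []} refl (ev b′ hd) , e)
      case₄ : ∀ {x y y′ y″} → In x → Sem (step f g) x y → Sem Tl y y′ → Sem Hd y′ y″ → y″ ≡ ν 0 →
              ¬ ¬ (M , x ⊨ᴴ ⟨ Decᴿ ⟩ ⟨ V q ⟩ c)
      case₄ ix (ev b (step d)) (ev b′ tl) (ev b″ hd) e k =
        k (_ , in′ {nom 7 ∷ []} refl (ev (dec-bounded ix) dec)
          , _ , in′ {q} eq (ev b″ d) , e)
      case₅ : ∀ {x y y′ y″} → In x → Sem (step f g) x y → Sem Tl y y′ → Sem Tl y′ y″ → y″ ≡ ν 0 →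
              ¬ ¬ (M , x ⊨ᴴ ⟨ Tlᴿ ⟩ c)
      case₅ ix (ev b (step d)) (ev b′ tl) (ev b″ tl) e k =
        k (_ , in′ {nom 5 ∷ []} refl (ev b″ tl) , e)

    -- Inverting a bounded evaluation gives just the evaluations of the parts that the law asks for,
    -- and the bounds stored in it keep the intermediate lists in the model.
    ok⊨ : ∀ {n} (f : Rec n) q → thing h q ≡ fun f → ∀ {x} → In x → M , x ⊨ᴴ ok f q
    oks⊨ : ∀ {m n} (gs : Vec (Rec n) m) q → thing h q ≡ funs gs → ∀ {x} → In x → M , x ⊨ᴴ oks gs q

    ok⊨ zero q eq ix (_ , r , k) = case (out {q} eq r) k
      where
      case : ∀ {n x y} → Sem (fun (zero {n})) x y → ¬ ¬ (y ≡ pt (0 ∷ []))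
      case (ev _ zero) k = k refl
    ok⊨ suc q eq ix = (λ ((_ , r , _ , s , e) , k) → case₁ ix (out {q} eq r) (out {nom 6 ∷ []} refl s) e k)
                    , (λ (_ , r , e) → case₂ (out {q} eq r) e)
      where
      case₁ : ∀ {x y y′} → In x → Sem (fun suc) x y → Sem P y y′ → y′ ≡ ν 0 → ¬ ¬ (M , x ⊨ᴴ ⟨ Hdᴿ ⟩ c)
      case₁ ix (ev b suc) (ev b′ pred) e k = k (_ , in′ {nom 4 ∷ []} refl (ev b′ hd) , e)
      case₂ : ∀ {x y} → Sem (fun suc) x y → y ≢ pt (0 ∷ [])
      case₂ (ev _ suc) ()
    ok⊨ (proj i) q eq ix ((_ , r , e) , k) = case ix (out {q} eq r) e k
      where
      case : ∀ {x y} → In x → Sem (fun (proj i)) x y → y ≡ ν 0 → ¬ ¬ (M , x ⊨ᴴ nth (toℕ i))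
      case ix (ev b (proj n)) e k = k (nth⊨ ix n e)
    ok⊨ (comp f gs) q eq ix =
        (λ ((_ , r , e) , k) → case (out {q} eq r) e k)
      , to-U (V (q / 1))
      , ok⊨ f (q / 0) (cong (child 0) eq) ix
      , oks⊨ gs (q / 1) (cong (child 1) eq) ix
      where
      case : ∀ {x y} → Sem (fun (comp f gs)) x y → y ≡ ν 0 →
             ¬ ¬ (M , x ⊨ᴴ ⟨ V (q / 1) ⟩ ⟨ V (q / 0) ⟩ c)
      case (ev b (comp d b′ d′)) e k =
        k (_ , in′ {q / 1} (cong (child 1) eq) (ev b′ d)
          , _ , in′ {q / 0} (cong (child 0) eq) (ev b d′) , e)
    ok⊨ (prec f g) q eq ix = prec⊨ f g q eq ix
                           , ok⊨ f (q / 0) (cong (child 0) eq) ix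
                           , ok⊨ g (q / 1) (cong (child 1) eq) ix
    ok⊨ (min f) q eq ix =
        (λ ((_ , r , e) , k) → case (out {q} eq r) e k)
      , search⊨ f (q / 0) (q / 1) (cong (child 0) eq) (cong (child 1) eq) ix
      , ok⊨ f (q / 0) (cong (child 0) eq) ix
      where
      case : ∀ {x y} → Sem (fun (min f)) x y → y ≡ ν 0 →
             ¬ ¬ (M , x ⊨ᴴ ⟨ Zcᴿ ⟩ ⟨ V (q / 1) ⟩ c)
      case (ev b (min b′ d)) e k =
        k (_ , in′ {nom 8 ∷ []} refl (ev b′ zc)
          , _ , in′ {q / 1} (cong (child 1) eq) (ev b d) , e)

    oks⊨ []       q eq ix = tt
    oks⊨ (g ∷ gs) q eq ix =
        (λ ((_ , r , _ , s , e) , k) → case₁ (out {q} eq r) (out {nom 4 ∷ []} refl s) e k)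
      , (λ ((_ , r , _ , s , e) , k) → case₂ (out {q} eq r) (out {nom 5 ∷ []} refl s) e k)
      , ok⊨ g (q / 0) (cong (child 0) eq) ix
      , oks⊨ gs (q / 1) (cong (child 1) eq) ix
      where
      case₁ : ∀ {x y y′} → Sem (funs (g ∷ gs)) x y → Sem Hd y y′ → y′ ≡ ν 0 →
              ¬ ¬ (M , x ⊨ᴴ ⟨ V (q / 0) ⟩ c)
      case₁ (ev b (d ∷ _)) (ev b′ hd) e k = k (_ , in′ {q / 0} (cong (child 0) eq) (ev b′ d) , e)
      case₂ : ∀ {x y y′} → Sem (funs (g ∷ gs)) x y → Sem Tl y y′ → y′ ≡ ν 0 →
              ¬ ¬ (M , x ⊨ᴴ ⟨ V (q / 1) ⟩ c)
      case₂ (ev b (_ ∷ d)) (ev b′ tl) e k = k (_ , in′ {q / 1} (cong (child 1) eq) (ev b′ d) , e)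

    num⊨ : ∀ k → M , pt (k ∷ []) ⊨ᴴ num k
    num⊨ zero    = refl
    num⊨ (suc k) = (λ ()) , λ (_ , r , j) → case (out {nom 6 ∷ []} refl r) j
      where
      case : ∀ {y} → Sem P (pt (suc k ∷ [])) y → ¬ ¬ (M , y ⊨ᴴ num k)
      case (ev b pred) j = j (num⊨ k)

    hd⊨ : ∀ k l → M , pt (k ∷ l) ⊨ᴴ (□ Hdᴿ) (num k)
    hd⊨ k l (_ , r , j) = case (out {nom 4 ∷ []} refl r) j
      where
      case : ∀ {y} → Sem Hd (pt (k ∷ l)) y → ¬ ¬ (M , y ⊨ᴴ num k)
      case (ev b hd) j = j (num⊨ k)

    root⊨ : ∀ {a b v} → Bounded B (a ∷ b ∷ []) → Bounded B (suc v ∷ []) →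
            Ev B (fun h) (a ∷ b ∷ []) (suc v ∷ []) → M , top ⊨ᴴ root a b
    root⊨ {a} {b} bl bv d =
      pt (a ∷ b ∷ []) , in′ {nom 0 ∷ []} refl (all bl)
        , (_ , in′ {[]} refl (ev bv d) , λ ())
        , hd⊨ a (b ∷ [])
        , λ (_ , r , j) → case (out {nom 5 ∷ []} refl r) j
      where
      case : ∀ {y} → Sem Tl (pt (a ∷ b ∷ [])) y → ¬ ¬ (M , y ⊨ᴴ (□ Hdᴿ) (num b))
      case (ev b tl) j = j (hd⊨ _ [])

    theory⊨ : ¬ (M , top ⊨ᴴ infinite) → M , top ⊨ᴴ theory h
    theory⊨ fin =
        (λ ((_ , _ , _ , r , e) , k) → k (_ , in′ {nom 0 ∷ []} refl (all (sem-In (out {nom 0 ∷ []} refl r))) , e))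
      , (λ (_ , r , k) → k ( base⊨ (sem-In (out {nom 0 ∷ []} refl r))
                           , ok⊨ h [] refl (sem-In (out {nom 0 ∷ []} refl r))))
      , fin

  -- The graph of the successor function, which is injective and misses column 0.
  Succ : Pt ℕ → Set
  Succ (gr a b) = b ≡ suc a
  Succ _        = ⊥

  infinite-ℕ : ∀ ν → std ℕ Succ ν , top ⊨ᴴ infinite
  infinite-ℕ ν =
      (λ (_ , r , k) → case₁ (out {nom 1 ∷ []} refl r) k)
    , (λ (_ , _ , k) → k λ (p , k) → k λ (_ , r , k) → k λ q → case₂ (out {nom 3 ∷ []} refl r) p q)
    , (gr 0 0 , in′ {nom 1 ∷ []} refl grd , (λ ()) , λ (_ , r , k) → k λ q → case₃ (out {nom 3 ∷ []} refl r) q)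
    where
    open Verify ℕ Succ ν
    case₁ : ∀ {x} → Sem G top x → ¬ ¬ (M , x ⊨ᴴ ⟨ Rowᴿ ⟩ p)
    case₁ (grd {a} {b}) k = k (gr a (suc a) , in′ {nom 2 ∷ []} refl row , refl)
    case₂ : ∀ {x y} → Sem Cn x y → Succ x → ¬ Succ y
    case₂ (col ≢) p q = ≢ (suc-injective (trans (sym p) q))
    case₃ : ∀ {y} → Sem Cn (gr 0 0) y → ¬ Succ y
    case₃ (col _) ()

-- The Ehrenfeucht-Fraïssé game between grids

-- The symbols whose interpretation in `std D Q ν` depends on neither `Q` nor `ν`.
Observable : Symbol → Set
Observable (rel _)       = ⊤
Observable (var zero)    = ⊥
Observable (var (suc _)) = ⊤
Observable (nom _)       = ⊥

-- A quantifier may pick a grid point, which uses up two points of the side.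
cost : ∀ {n} → FO n → ℕ
cost (¬ᶠ φ)   = cost φ
cost (φ ∧ᶠ ψ) = cost φ + cost ψ
cost (∃ᶠ φ)   = 2 + cost φ
cost _        = 0

-- The size of the side in the form in which the game uses it: fewer than `N` picks never exhaust
-- `D`.
Large : ℕ → Set → Set
Large N D = ∀ {m} → m < N → (xs : Vec D m) → ∃ λ a → ∀ i → lookup xs i ≢ a

module Game (em : ExcludedMiddle 0ℓ) (h : Rec 2) (B N : ℕ) where
  open Std h B

  -- Otherwise sending `a` to a position of `f a` in `xs` would inject `Fin N` into `Fin m`.
  large : ∀ {D} (f : Fin N → D) → (∀ {i j} → f i ≡ f j → i ≡ j) → Large N D
  large f f-inj {m} m<N xs = decidable-stable em λ none →
    let hit : ∀ a → ∃ λ i → lookup xs i ≡ f a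
        hit a = decidable-stable em λ miss → none (f a , λ i e → miss (i , e))
    in <⇒≱ m<N (injective⇒≤ {f = λ a → proj₁ (hit a)} λ {a} {b} e →
         f-inj (trans (sym (proj₂ (hit a))) (trans (cong (lookup xs) e) (proj₂ (hit b)))))

  module _ {D E : Set} where

    data At {m} (xs : Vec D m) (ys : Vec E m) (a : D) (b : E) : Set where
      index : ∀ i → lookup xs i ≡ a → lookup ys i ≡ b → At xs ys a b

    -- List points correspond to themselves, so the game is really played on the sides `D` and `E`,
    -- whose picked elements are collected in `xs` and `ys`.
    data Sim {m} (xs : Vec D m) (ys : Vec E m) : Pt D → Pt E → Set where
      top : Sim xs ys top top
      pt  : ∀ l → Sim xs ys (pt l) (pt l)
      gr  : ∀ {a a′ b b′} → At xs ys a a′ → At xs ys b b′ → Sim xs ys (gr a b) (gr a′ b′)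

    Functional : ∀ {m} → Vec D m → Vec E m → Set
    Functional xs ys = ∀ i j → lookup xs i ≡ lookup xs j → lookup ys i ≡ lookup ys j

    at-functional : ∀ {m} {xs : Vec D m} {ys} → Functional xs ys → ∀ {a a′ b b′} →
                    At xs ys a a′ → At xs ys b b′ → a ≡ b → a′ ≡ b′
    at-functional fn (index i refl refl) (index j refl refl) e = fn i j e

    sim-functional : ∀ {m} {xs : Vec D m} {ys} → Functional xs ys → ∀ {x x′ y y′} →
                     Sim xs ys x x′ → Sim xs ys y y′ → x ≡ y → x′ ≡ y′
    sim-functional fn top      top      _    = refl
    sim-functional fn (pt _)   (pt _)   refl = refl
    sim-functional fn (gr p q) (gr r s) refl =
      cong₂ gr (at-functional fn p r refl) (at-functional fn q s refl)

  swapᴬ : ∀ {D E m} {xs : Vec D m} {ys : Vec E m} {a b} → At xs ys a b → At ys xs b a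
  swapᴬ (index i p q) = index i q p

  swap : ∀ {D E m} {xs : Vec D m} {ys : Vec E m} {x y} → Sim xs ys x y → Sim ys xs y x
  swap top = top
  swap (pt l) = pt l
  swap (gr p q) = gr (swapᴬ p) (swapᴬ q)

  weaken : ∀ {D E m} {xs : Vec D m} {ys : Vec E m} {a b x y} → Sim xs ys x y → Sim (a ∷ xs) (b ∷ ys) x y
  weaken top = top
  weaken (pt l) = pt l
  weaken (gr (index i p q) (index j r s)) = gr (index (suc i) p q) (index (suc j) r s)

  -- The sides carry no structure besides equality, so a partial isomorphism is an agreement of
  -- equality patterns.
  record Match {D E : Set} {m} (xs : Vec D m) (ys : Vec E m) : Set where
    constructor match
    field
      forth : Functional xs ys
      back  : Functional ys xs
  open Match

  flip : ∀ {D E m} {xs : Vec D m} {ys : Vec E m} → Match xs ys → Match ys xs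
  flip (match f b) = match b f

  functional-∷ : ∀ {D E m} {xs : Vec D m} {ys : Vec E m} {a b} → Functional xs ys →
                 (∀ i → lookup xs i ≡ a → lookup ys i ≡ b) → Functional (a ∷ xs) (b ∷ ys)
  functional-∷ fn new zero    zero    e = refl
  functional-∷ fn new zero    (suc j) e = sym (new j (sym e))
  functional-∷ fn new (suc i) zero    e = new i e
  functional-∷ fn new (suc i) (suc j) e = fn i j e

  -- An element picked before is answered by its partner, a new one by an element outside `ys`.
  extend : ∀ {D E m} {xs : Vec D m} {ys : Vec E m} → Large N E → m < N → Match xs ys →
           ∀ a → ∃ λ b → Match (a ∷ xs) (b ∷ ys)
  extend {xs = xs} {ys} lg m<N (match f b) a with em {∃ λ i → lookup xs i ≡ a}
  ... | yes (i , refl) = lookup ys i , match (functional-∷ f (λ j e → f j i e))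
                                             (functional-∷ b (λ j e → b j i e))
  ... | no miss with lg m<N ys
  ...   | y , fresh = y , match (functional-∷ f (λ i e → contradiction (i , e) miss))
                                (functional-∷ b (λ i e → contradiction e (fresh i)))

  sem-transfer : ∀ {D E m} {xs : Vec D m} {ys : Vec E m} → Match xs ys → ∀ {t x x′ y y′} →
                 Sim xs ys x x′ → Sim xs ys y y′ → Sem t x y → Sem t x′ y′
  sem-transfer mt p top      (all i)  = all i
  sem-transfer mt p (pt l)   (all i)  = all i
  sem-transfer mt p (gr _ _) (all i)  = all i
  sem-transfer mt top (gr _ _) grd    = grd
  sem-transfer mt (gr a b) (gr a′ b′) row
    with at-functional (forth mt) a a′ refl
  ... | refl = row
  sem-transfer mt (gr a b) (gr a′ b′) (col ne)
    with at-functional (forth mt) b b′ refl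
  ... | refl = col λ e → ne (at-functional (back mt) (swapᴬ a) (swapᴬ a′) e)
  sem-transfer mt (pt _) (pt _) (ev b e) = ev b e

  Sims : ∀ {D E m n} → Vec D m → Vec E m → Vec (Pt D) n → Vec (Pt E) n → Set
  Sims xs ys ρ ρ′ = ∀ i → Sim xs ys (lookup ρ i) (lookup ρ′ i)

  -- `m` coordinates have been picked and `cost φ` bounds those still to come. Negation exchanges
  -- the two models, hence largeness of both sides.
  preserve : ∀ {D E Q Q′ ν ν′} → Large N D → Large N E →
             ∀ {n} (φ : FO n) → (∀ {s} → s ∈ sig φ → Observable s) →
             ∀ {m} {xs : Vec D m} {ys : Vec E m} → m + cost φ ≤ N → Match xs ys →
             ∀ {ρ ρ′} → Sims xs ys ρ ρ′ → std D Q ν , ρ ⊨ᶠ φ → std E Q′ ν′ , ρ′ ⊨ᶠ φ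
  preserve lD lE ⊤ᶠ ob le mt ss t = t
  preserve lD lE (var i ≐ var j) ob le mt ss e = sim-functional (forth mt) (ss i) (ss j) e
  preserve lD lE (var i ≐ nom a) ob le mt ss e = ⊥-elim (ob (here refl))
  preserve lD lE (nom a ≐ t) ob le mt ss e = ⊥-elim (ob (here refl))
  preserve lD lE (varᶠ v (nom a)) ob le mt ss e = ⊥-elim (ob (there (here refl)))
  preserve lD lE (varᶠ 0 (var i)) ob le mt ss e = ⊥-elim (ob (here refl))
  preserve lD lE (varᶠ 1 (var i)) ob le mt ss e = zero-transfer (ss i) e
    where
    zero-transfer : ∀ {D E m x y} {xs : Vec D m} {ys : Vec E m} → Sim xs ys x y →
                    x ≡ pt (0 ∷ []) → y ≡ pt (0 ∷ [])
    zero-transfer (pt _) refl = refl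
  preserve lD lE (varᶠ (suc (suc v)) (var i)) ob le mt ss e = e
  preserve lD lE (relᶠ R (nom a) t) ob le mt ss e = ⊥-elim (ob (there (here refl)))
  preserve lD lE (relᶠ R (var i) (nom a)) ob le mt ss e = ⊥-elim (ob (there (here refl)))
  preserve lD lE (relᶠ R (var i) (var j)) ob le mt ss (q , e , s) =
    q , e , sem-transfer mt (ss i) (ss j) s
  preserve lD lE (¬ᶠ φ) ob le mt ss k l = k (preserve lE lD φ ob le (flip mt) (λ i → swap (ss i)) l)
  preserve lD lE (φ ∧ᶠ ψ) ob {m} le mt ss (k , l) =
      preserve lD lE φ (ob ∘ ∈-++⁺ˡ) (≤-trans (+-monoʳ-≤ m (m≤m+n (cost φ) (cost ψ))) le) mt ss k
    , preserve lD lE ψ (ob ∘ ∈-++⁺ʳ (sig φ)) (≤-trans (+-monoʳ-≤ m (m≤n+m (cost ψ) (cost φ))) le) mt ss l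
  preserve {D} {E} lD lE (∃ᶠ φ) ob {m} {xs} {ys} le mt {ρ} {ρ′} ss (w , k) = choose w k
    where
    le₂ : 2 + (m + cost φ) ≤ N
    le₂ = ≤-trans (≤-reflexive (sym (trans (+-suc m (suc (cost φ))) (cong suc (+-suc m (cost φ)))))) le
    le₀ : m + cost φ ≤ N
    le₀ = <⇒≤ (<⇒≤ le₂)
    choose : ∀ w → std D _ _ , w ∷ ρ ⊨ᶠ φ → ∃ λ w → std E _ _ , w ∷ ρ′ ⊨ᶠ φ
    choose top    k = top  , preserve lD lE φ ob le₀ mt (λ { zero → top  ; (suc i) → ss i }) k
    choose (pt l) k = pt l , preserve lD lE φ ob le₀ mt (λ { zero → pt l ; (suc i) → ss i }) k
    -- The two coordinates are answered one after the other, the second with the first already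
    -- matched; this is the 2 in `cost`.
    choose (gr a b) k with extend lE (≤-trans (s≤s (m≤m+n m (cost φ))) (<⇒≤ le₂)) mt a
    ... | a′ , mt₁ with extend lE (≤-trans (s≤s (s≤s (m≤m+n m (cost φ)))) le₂) mt₁ b
    ... | b′ , mt₂ = gr a′ b′ , preserve lD lE φ ob le₂ mt₂
      (λ { zero → gr (index (suc zero) refl refl) (index zero refl refl)
         ; (suc i) → weaken (weaken (ss i)) }) k

  -- Pigeonhole: each row has a marked column, different rows have different ones, and together with
  -- the missed column they inject `Fin (suc n)` into `Fin n`.
  finite-Fin : ∀ n Q ν → ¬ (std (Fin n) Q ν , top ⊨ᴴ infinite)
  finite-Fin n Q ν (serial , inj , x₀ , r₀ , ¬p₀ , miss) = contradict (out {nom 1 ∷ []} refl r₀) ¬p₀ miss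
    where
    open Verify (Fin n) Q ν
    stable : ∀ {P : Set} → ¬ ¬ P → P
    stable = decidable-stable em
    column : ∀ a → ∃ λ b → Q (gr a b)
    column a with stable (λ k → serial (gr a a , in′ {nom 1 ∷ []} refl grd , k))
    ... | _ , r , q with out {nom 2 ∷ []} refl r
    ... | row = _ , q
    unique : ∀ {a a′ b} → Q (gr a b) → Q (gr a′ b) → a ≡ a′
    unique {a} {a′} {b} q q′ = stable λ ne →
      inj (gr a b , in′ {nom 1 ∷ []} refl grd , λ k →
        k (q , λ l → l (gr a′ b , in′ {nom 3 ∷ []} refl (col ne) , λ l → l q′)))
    contradict : ∀ {x} → Sem G top x → ¬ Q x → ¬ (M , x ⊨ᴴ (□ Cnᴿ) (¬ᴴ p))
    contradict (grd {a₀} {b₀}) ¬q miss = 1+n≰n (injective⇒≤ {f = f} λ {i} {j} → f-inj i j)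
      where
      missed : ∀ a → ¬ Q (gr a b₀)
      missed a q with em {a₀ ≡ a}
      ... | yes refl = ¬q q
      ... | no ne    = miss (gr a b₀ , in′ {nom 3 ∷ []} refl (col ne) , λ k → k q)
      f : Fin (suc n) → Fin n
      f zero    = b₀
      f (suc a) = proj₁ (column a)
      f-inj : ∀ i j → f i ≡ f j → i ≡ j
      f-inj zero    zero    e = refl
      f-inj zero    (suc a) e = contradiction (subst (Q ∘ gr a) (sym e) (proj₂ (column a))) (missed a)
      f-inj (suc a) zero    e = contradiction (subst (Q ∘ gr a) e (proj₂ (column a))) (missed a)
      f-inj (suc a) (suc b) e =
        cong suc (unique (proj₂ (column a)) (subst (Q ∘ gr b) (sym e) (proj₂ (column b))))

-- Diagrams of standard models over a finite side

lists : ℕ → ℕ → List (List ℕ)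
lists B zero    = [] ∷ []
lists B (suc m) = [] ∷ cartesianProductWith _∷_ (upTo (suc B)) (lists B m)

∈-lists : ∀ {B m l} → length l ≤ m → All (_≤ B) l → l ∈ lists B m
∈-lists {m = zero}  {[]}    _        _       = here refl
∈-lists {m = suc m} {[]}    _        _       = here refl
∈-lists {m = suc m} {x ∷ l} (s≤s le) (p ∷ q) =
  there (∈-cartesianProductWith⁺ _∷_ (∈-upTo⁺ (s≤s p)) (∈-lists le q))

points : (B n : ℕ) → List (Pt (Fin n))
points B n = map pt (lists B B) ++ cartesianProductWith gr (allFin n) (allFin n)

-- The default `x` lets all of the infinitely many nominals be interpreted from a finite list.
at : ∀ {A : Set} → A → List A → ℕ → A
at x []       _       = x
at x (y ∷ ys) zero    = y
at x (y ∷ ys) (suc i) = at x ys i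

∈-at : ∀ {A : Set} (d : A) {x xs} → x ∈ xs → ∃ λ i → i < length xs × x ≡ at d xs i
∈-at d (here refl) = 0 , s≤s z≤n , refl
∈-at d (there m) with ∈-at d m
... | i , lt , e = suc i , s≤s lt , e

observables : H → Signature
observables ⊤ᴴ             = []
observables (varᴴ zero)    = []
observables (varᴴ (suc v)) = var (suc v) ∷ []
observables (nomᴴ a)       = []
observables (¬ᴴ φ)         = observables φ
observables (φ ∧ᴴ ψ)       = observables φ ++ observables ψ
observables (⟨ R ⟩ φ)      = rel R ∷ observables φ

observables-observable : ∀ φ {s} → s ∈ observables φ → Observable s
observables-observable (varᴴ (suc v)) (here refl) = tt
observables-observable (¬ᴴ φ) m = observables-observable φ m
observables-observable (φ ∧ᴴ ψ) m =
  [ observables-observable φ , observables-observable ψ ]′ (∈-++⁻ (observables φ) m)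
observables-observable (⟨ R ⟩ φ) (here refl) = tt
observables-observable (⟨ R ⟩ φ) (there m)   = observables-observable φ m

-- Keeps the nominals `suc i` fresh, to serve as names in the diagram.
OnlyNom₀ : H → Set
OnlyNom₀ (nomᴴ (suc a)) = ⊥
OnlyNom₀ (¬ᴴ φ)         = OnlyNom₀ φ
OnlyNom₀ (φ ∧ᴴ ψ)       = OnlyNom₀ φ × OnlyNom₀ ψ
OnlyNom₀ (⟨ R ⟩ φ)      = OnlyNom₀ φ
OnlyNom₀ _              = ⊤

onlyNom₀-nth : ∀ i → OnlyNom₀ (nth i)
onlyNom₀-nth zero    = tt
onlyNom₀-nth (suc i) = onlyNom₀-nth i

onlyNom₀-ok  : ∀ {n} (f : Rec n) q → OnlyNom₀ (ok f q)
onlyNom₀-oks : ∀ {m n} (gs : Vec (Rec n) m) q → OnlyNom₀ (oks gs q)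
onlyNom₀-ok zero        q = tt
onlyNom₀-ok suc         q = _
onlyNom₀-ok (proj i)    q = tt , onlyNom₀-nth (toℕ i)
onlyNom₀-ok (comp f gs) q = _ , _ , onlyNom₀-ok f _ , onlyNom₀-oks gs _
onlyNom₀-ok (prec f g)  q = _ , onlyNom₀-ok f _ , onlyNom₀-ok g _
onlyNom₀-ok (min f)     q = _ , _ , onlyNom₀-ok f _
onlyNom₀-oks []       q = tt
onlyNom₀-oks (g ∷ gs) q = _ , _ , onlyNom₀-ok g _ , onlyNom₀-oks gs _

Within : Signature → H → Set
Within σ ⊤ᴴ             = ⊤
Within σ (varᴴ zero)    = ⊤
Within σ (varᴴ (suc v)) = var (suc v) ∈ σ
Within σ (nomᴴ zero)    = ⊤
Within σ (nomᴴ (suc a)) = ⊥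
Within σ (¬ᴴ φ)         = Within σ φ
Within σ (φ ∧ᴴ ψ)       = Within σ φ × Within σ ψ
Within σ (⟨ R ⟩ φ)      = rel R ∈ σ × Within σ φ

within : ∀ {σ} φ → OnlyNom₀ φ → observables φ ⊆ σ → Within σ φ
within ⊤ᴴ             o m = tt
within (varᴴ zero)    o m = tt
within (varᴴ (suc v)) o m = m (here refl)
within (nomᴴ zero)    o m = tt
within (¬ᴴ φ)         o m = within φ o m
within (φ ∧ᴴ ψ) (o , o′) m = within φ o (m ∘ ∈-++⁺ˡ) , within ψ o′ (m ∘ ∈-++⁺ʳ (observables φ))
within (⟨ R ⟩ φ)      o m = m (here refl) , within φ o (m ∘ there)

Hidden : Symbol → Set
Hidden s = s ≡ nom 0 ⊎ s ≡ var 0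

sig-within : ∀ {σ n} {x : Fin n} φ → Within σ φ → ∀ {s} → s ∈ sig (T x φ) → s ∈ σ ⊎ Hidden s
sig-within (varᴴ zero)    w (here refl) = inj₂ (inj₂ refl)
sig-within (varᴴ (suc v)) w (here refl) = inj₁ w
sig-within (nomᴴ zero)    w (here refl) = inj₂ (inj₁ refl)
sig-within (¬ᴴ φ)         w m = sig-within φ w m
sig-within {x = x} (φ ∧ᴴ ψ) (w , w′) m =
  [ sig-within φ w , sig-within ψ w′ ]′ (∈-++⁻ (sig (T x φ)) m)
sig-within (⟨ R ⟩ φ) (w , w′) (here refl) = inj₁ w
sig-within (⟨ R ⟩ φ) (w , w′) (there m)   = sig-within φ w′ m

NoHidden : H → Set
NoHidden ⊤ᴴ        = ⊤
NoHidden (varᴴ v)  = v ≢ 0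
NoHidden (nomᴴ a)  = a ≢ 0
NoHidden (¬ᴴ φ)    = NoHidden φ
NoHidden (φ ∧ᴴ ψ)  = NoHidden φ × NoHidden ψ
NoHidden (⟨ R ⟩ φ) = NoHidden φ

sig-noHidden : ∀ {n} {x : Fin n} φ → NoHidden φ → ∀ {s} → s ∈ sig (T x φ) → ¬ Hidden s
sig-noHidden (varᴴ v) n (here refl) (inj₂ refl) = n refl
sig-noHidden (nomᴴ a) n (here refl) (inj₁ refl) = n refl
sig-noHidden (¬ᴴ φ)   n m = sig-noHidden φ n m
sig-noHidden {x = x} (φ ∧ᴴ ψ) (n , n′) m =
  [ sig-noHidden φ n , sig-noHidden ψ n′ ]′ (∈-++⁻ (sig (T x φ)) m)
sig-noHidden (⟨ R ⟩ φ) n (here refl) (inj₁ ())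
sig-noHidden (⟨ R ⟩ φ) n (here refl) (inj₂ ())
sig-noHidden (⟨ R ⟩ φ) n (there m) = sig-noHidden φ n m

⋀ : ℕ → (ℕ → H) → H
⋀ zero    φ = ⊤ᴴ
⋀ (suc n) φ = φ n ∧ᴴ ⋀ n φ

⋀ˡ : ∀ {A : Set} → List A → (A → H) → H
⋀ˡ []       φ = ⊤ᴴ
⋀ˡ (x ∷ xs) φ = φ x ∧ᴴ ⋀ˡ xs φ

module _ {M : Model} {x : W M} where

  ⋀-intro : ∀ n {φ} → (∀ {i} → i < n → M , x ⊨ᴴ φ i) → M , x ⊨ᴴ ⋀ n φ
  ⋀-intro zero    f = tt
  ⋀-intro (suc n) f = f ≤-refl , ⋀-intro n (f ∘ m≤n⇒m≤1+n)

  ⋀-elim : ∀ n {φ} → M , x ⊨ᴴ ⋀ n φ → ∀ {i} → i < n → M , x ⊨ᴴ φ i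
  ⋀-elim (suc n) {φ} (h , hs) (s≤s le) with m≤n⇒m<n∨m≡n le
  ... | inj₁ lt   = ⋀-elim n hs lt
  ... | inj₂ refl = h

  ⋀ˡ-intro : ∀ {A : Set} (xs : List A) {φ} → (∀ a → M , x ⊨ᴴ φ a) → M , x ⊨ᴴ ⋀ˡ xs φ
  ⋀ˡ-intro []       f = tt
  ⋀ˡ-intro (a ∷ xs) f = f a , ⋀ˡ-intro xs f

  ⋀ˡ-elim : ∀ {A : Set} {xs : List A} {φ} → M , x ⊨ᴴ ⋀ˡ xs φ → ∀ {a} → a ∈ xs → M , x ⊨ᴴ φ a
  ⋀ˡ-elim (h , hs) (here refl) = h
  ⋀ˡ-elim (h , hs) (there m)   = ⋀ˡ-elim hs m

⋀-noHidden : ∀ n {φ} → (∀ i → NoHidden (φ i)) → NoHidden (⋀ n φ)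
⋀-noHidden zero    f = tt
⋀-noHidden (suc n) f = f n , ⋀-noHidden n f

⋀ˡ-noHidden : ∀ {A : Set} (xs : List A) {φ} → (∀ a → NoHidden (φ a)) → NoHidden (⋀ˡ xs φ)
⋀ˡ-noHidden []       f = tt
⋀ˡ-noHidden (a ∷ xs) f = f a , ⋀ˡ-noHidden xs f

signed : ∀ {P : Set} → Dec P → H → H
signed (yes _) φ = φ
signed (no _)  φ = ¬ᴴ φ

signed-intro : ∀ {P : Set} (d : Dec P) {M x φ} → (P → M , x ⊨ᴴ φ) → (M , x ⊨ᴴ φ → P) →
               M , x ⊨ᴴ signed d φ
signed-intro (yes a) f g = f a
signed-intro (no ¬a) f g = ¬a ∘ g

signed-elim : ∀ {P : Set} (d : Dec P) {M x φ} → M , x ⊨ᴴ signed d φ → P ⇔ (M , x ⊨ᴴ φ)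
signed-elim (yes a) h = mk⇔ (λ _ → h) (λ _ → a)
signed-elim (no ¬a) h = mk⇔ (λ a → contradiction a ¬a) (λ k → contradiction k h)

signed-noHidden : ∀ {P : Set} (d : Dec P) {φ} → NoHidden φ → NoHidden (signed d φ)
signed-noHidden (yes _) n = n
signed-noHidden (no _)  n = n

module Diagram (em : ExcludedMiddle 0ℓ) (h : Rec 2) (B n : ℕ) (σ : Signature) where
  open Std h B

  D : Set
  D = Fin n

  stable : ∀ {P : Set} → ¬ ¬ P → P
  stable = decidable-stable em

  K : ℕ
  K = suc (length (points B n))

  e : ℕ → Pt D
  e = at top (top ∷ points B n)

  covers : ∀ {x : Pt D} → In x → ∃ λ i → i < K × x ≡ e i
  covers {top}    _       = 0 , s≤s z≤n , refl
  covers {pt l}   (p , q) = ∈-at top (there (∈-++⁺ˡ (∈-map⁺ pt (∈-lists p q))))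
  covers {gr a b} _       =
    ∈-at top (there (∈-++⁺ʳ (map pt (lists B B)) (∈-cartesianProductWith⁺ gr (∈-allFin a) (∈-allFin b))))

  ν : Nom → Pt D
  ν zero    = top
  ν (suc i) = e i

  M : Model
  M = std D (λ _ → ⊥) ν

  name : ℕ → H
  name i = nomᴴ (suc i)

  lit : ℕ → Symbol → H
  lit i (rel R)       = ⋀ K (λ j → signed (em {relᴹ M R (e i) (e j)}) (⟨ R ⟩ name j))
                     -- Every successor bears a name: a disjunction written with negations.
                     ∧ᴴ (□ R) (¬ᴴ ⋀ K (λ j → ¬ᴴ name j))
  lit i (var (suc v)) = signed (em {varᴹ M (suc v) (e i)}) (varᴴ (suc v))
  lit i _             = ⊤ᴴ

  local : ℕ → H
  local i = ⋀ K (λ j → signed (em {e i ≡ e j}) (name j)) ∧ᴴ ⋀ˡ σ (lit i)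

  -- There is no satisfaction operator, so `Uᴿ`, which leads from `top` to all of `In`, carries the
  -- description to each named point.
  diagram : H
  diagram = name 0 ∧ᴴ ⋀ K (λ i → signed (em {In (e i)}) (⟨ Uᴿ ⟩ (name i ∧ᴴ local i)))

  lit-noHidden : ∀ i s → NoHidden (lit i s)
  lit-noHidden i (rel R)       = ⋀-noHidden K (λ j → signed-noHidden em {⟨ R ⟩ name j} (λ ()))
                               , ⋀-noHidden K (λ _ ())
  lit-noHidden i (var zero)    = tt
  lit-noHidden i (var (suc v)) = signed-noHidden em {varᴴ (suc v)} λ ()
  lit-noHidden i (nom a)       = tt

  diagram-noHidden : NoHidden diagram
  diagram-noHidden = (λ ()) , ⋀-noHidden K λ i →
    signed-noHidden em {⟨ Uᴿ ⟩ (name i ∧ᴴ local i)}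
      ( (λ ())
      , ⋀-noHidden K (λ j → signed-noHidden em {name j} λ ())
      , ⋀ˡ-noHidden σ (lit-noHidden i))

  rel-In : ∀ {R} {x y : Pt D} → relᴹ M R x y → In y
  rel-In (_ , _ , s) = sem-In s

  lit⊨ : ∀ i s → M , e i ⊨ᴴ lit i s
  lit⊨ i (rel R) =
      ⋀-intro K (λ {j} _ → signed-intro em {M} {e i} {⟨ R ⟩ name j} (λ r → e j , r , refl) λ { (_ , r , refl) → r })
    , λ (y , r , k) → k λ ns → cover ns (covers (rel-In r))
    where
    cover : ∀ {y} → M , y ⊨ᴴ ⋀ K (λ j → ¬ᴴ name j) → ¬ (∃ λ j → j < K × y ≡ e j)
    cover ns (j , lt , refl) = ⋀-elim K ns lt refl
  lit⊨ i (var zero)    = tt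
  lit⊨ i (var (suc v)) = signed-intro em {M} {e i} {varᴴ (suc v)} id id
  lit⊨ i (nom a)       = tt

  local⊨ : ∀ i → M , e i ⊨ᴴ local i
  local⊨ i = ⋀-intro K (λ {j} _ → signed-intro em {M} {e i} {name j} id id) , ⋀ˡ-intro σ (lit⊨ i)

  diagram⊨ : M , top ⊨ᴴ diagram
  diagram⊨ = refl , ⋀-intro K λ {i} _ →
    signed-intro em {M} {top} {⟨ Uᴿ ⟩ (name i ∧ᴴ local i)}
      (λ ii → e i , (nom 0 ∷ [] , refl , all ii) , refl , local⊨ i)
      (λ { (_ , r , refl , _) → rel-In r })

  module Transfer (N : Model) (v : W N) (hyp : N , v ⊨ᴴ diagram) where

    [_]ᴺ : ℕ → W N
    [ i ]ᴺ = nomᴹ N (suc i)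

    at-local : ∀ {i} → i < K → In (e i) → N , [ i ]ᴺ ⊨ᴴ local i
    at-local {i} lt ii
      with Equivalence.to (signed-elim em {N} {v} {⟨ Uᴿ ⟩ (name i ∧ᴴ local i)} (⋀-elim K (proj₂ hyp) lt)) ii
    ... | _ , _ , refl , l = l

    same : ∀ {i j} → i < K → In (e i) → j < K → (e i ≡ e j) ⇔ ([ i ]ᴺ ≡ [ j ]ᴺ)
    same {i} {j} lt ii lt′ = signed-elim em {N} {_} {name j} (⋀-elim K (proj₁ (at-local lt ii)) lt′)

    at-lit : ∀ {i s} → i < K → In (e i) → s ∈ σ → N , [ i ]ᴺ ⊨ᴴ lit i s
    at-lit lt ii m = ⋀ˡ-elim (proj₂ (at-local lt ii)) m

    Q : Pt D → Set
    Q y = ∃ λ i → i < K × y ≡ e i × varᴹ N 0 [ i ]ᴺ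

    -- Interprets the hidden nominal when its value is not a named point.
    outside : Pt D
    outside = pt (replicate (suc B) 0)

    outside-∉ : ¬ In outside
    outside-∉ (le , _) = 1+n≰n (subst (_≤ B) (length-replicate (suc B)) le)

    Named : Set
    Named = ∃ λ i → i < K × In (e i) × [ i ]ᴺ ≡ nomᴹ N 0

    hidden : Dec Named → Pt D
    hidden (yes (i , _)) = e i
    hidden (no _)        = outside

    μ : Nom → Pt D
    μ _ = hidden em

    N′ : Model
    N′ = std D Q μ

    hidden-⇔ : ∀ {i} (d : Dec Named) → i < K → In (e i) → ([ i ]ᴺ ≡ nomᴹ N 0) ⇔ (e i ≡ hidden d)
    hidden-⇔ (yes (j , lt′ , ij , eq)) lt ii =
      mk⇔ (λ p → from (trans p (sym eq))) (λ p → trans (to p) eq)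
      where open Equivalence (same lt ii lt′)
    hidden-⇔ {i} (no ¬a) lt ii =
      mk⇔ (λ p → contradiction (i , lt , ii , p) ¬a) (λ p → contradiction (subst In p ii) outside-∉)

    -- By the diagram, the named points of `N` copy those of `M` and are closed under the relations
    -- in `σ`. The hidden symbols of `N′` are read off from `N` through the names, and its relations
    -- are those of `M`.
    transfer : ∀ φ → Within σ φ → ∀ {i} → i < K → In (e i) →
               (N , [ i ]ᴺ ⊨ᴴ φ) ⇔ (N′ , e i ⊨ᴴ φ)
    transfer ⊤ᴴ w lt ii = mk⇔ id id
    transfer (varᴴ zero) w lt ii =
      mk⇔ (λ q → _ , lt , refl , q)
          (λ (j , lt′ , eq , q) → subst (varᴹ N 0) (sym (Equivalence.to (same lt ii lt′) eq)) q)
    transfer (varᴴ (suc zero)) w {i} lt ii = mk⇔ from to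
      where open Equivalence (signed-elim em {N} {_} {varᴴ 1} (at-lit lt ii w))
    transfer (varᴴ (suc (suc v))) w {i} lt ii = mk⇔ from to
      where open Equivalence (signed-elim em {N} {_} {varᴴ (suc (suc v))} (at-lit lt ii w))
    transfer (nomᴴ zero) w lt ii = hidden-⇔ em lt ii
    transfer (¬ᴴ φ) w lt ii = mk⇔ (λ h k → h (from k)) (λ h k → h (to k))
      where open Equivalence (transfer φ w lt ii)
    transfer (φ ∧ᴴ ψ) (w , w′) lt ii =
      mk⇔ (λ (h , k) → I.to h , J.to k) (λ (h , k) → I.from h , J.from k)
      where module I = Equivalence (transfer φ w lt ii)
            module J = Equivalence (transfer ψ w′ lt ii)
    transfer (⟨ R ⟩ φ) (w , w′) {i} lt ii = mk⇔ forth back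
      where
      edge : ∀ {j} → j < K → relᴹ M R (e i) (e j) ⇔ (N , [ i ]ᴺ ⊨ᴴ ⟨ R ⟩ name j)
      edge {j} lt′ = signed-elim em {N} {_} {⟨ R ⟩ name j} (⋀-elim K (proj₁ (at-lit lt ii w)) lt′)
      forth : N , [ i ]ᴺ ⊨ᴴ ⟨ R ⟩ φ → N′ , e i ⊨ᴴ ⟨ R ⟩ φ
      forth (u , r , k) = stable λ l → proj₂ (at-lit lt ii w) (u , r , λ j → j
        (⋀-intro K λ {j} lt′ → λ { refl →
          let r′ = Equivalence.from (edge lt′) (u , r , refl)
          in l (e j , r′ , Equivalence.to (transfer φ w′ lt′ (rel-In r′)) k) }))
      back : N′ , e i ⊨ᴴ ⟨ R ⟩ φ → N , [ i ]ᴺ ⊨ᴴ ⟨ R ⟩ φ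
      back (y , r , k) with covers (rel-In r)
      ... | j , lt′ , refl with Equivalence.to (edge lt′) r
      ... | _ , r′ , refl = _ , r′ , Equivalence.from (transfer φ w′ lt′ (rel-In r)) k

    transfer-root : ∀ φ → Within σ φ → N , v ⊨ᴴ φ → N′ , top ⊨ᴴ φ
    transfer-root φ w k =
      -- Index 0 names `top`, and the first conjunct of the diagram gives this name to `v`.
      Equivalence.to (transfer φ w (s≤s z≤n) tt) (subst (λ x → N , x ⊨ᴴ φ) (proj₁ hyp) k)

-- Interpolants from the value 0, none from a nonzero value

-- The symbols of `root` are listed independently of the seeds, since the code of this very list is
-- going to be a seed.
signature : Rec 2 → Signature
signature h = rel Uᴿ ∷ rel (V []) ∷ rel Hdᴿ ∷ rel Tlᴿ ∷ rel Pᴿ ∷ var 1 ∷ observables (theory h)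

signature-observable : ∀ h {s} → s ∈ signature h → Observable s
signature-observable h (here refl) = tt
signature-observable h (there (here refl)) = tt
signature-observable h (there (there (here refl))) = tt
signature-observable h (there (there (there (here refl)))) = tt
signature-observable h (there (there (there (there (here refl))))) = tt
signature-observable h (there (there (there (there (there (here refl)))))) = tt
signature-observable h (there (there (there (there (there (there m)))))) =
  observables-observable (theory h) m

inst-within : ∀ h a b → Within (signature h) (inst (theory h) a b)
inst-within h a b =
    within (theory h) (_ , (_ , onlyNom₀-ok h []) , _)
      (λ m → there (there (there (there (there (there m))))))
  , here refl , (there (here refl) , z∈) , (hd∈ , num-within a)
  , there (there (there (here refl))) , hd∈ , num-within b
  where
  z∈ : var 1 ∈ signature h
  z∈ = there (there (there (there (there (here refl)))))
  hd∈ : rel Hdᴿ ∈ signature h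
  hd∈ = there (there (here refl))
  num-within : ∀ k → Within (signature h) (num k)
  num-within zero    = z∈
  num-within (suc k) = z∈ , there (there (there (there (here refl)))) , num-within k

module _ (em : ExcludedMiddle 0ℓ) {ℓ} (L : Logic ℓ) (L⊇H : ContainsH L) (h : Rec 2) (a b : ℕ) where

  -- By `unsatisfiable`, every pointed model satisfies the instance after a suitable reset of `c`. A
  -- consequence `ψ` of the permitted kind cannot mention `c`, so it holds before the reset as well.
  hasInterpolant : h ⟦ a ∷ b ∷ [] ⟧⇓ 0 → ∃ (IsUniformInterpolant L (signature h) (T zero (inst (theory h) a b)))
  hasInterpolant d = ⊤ᶠ , record
    { χ∈L = L⊇H ⊤ᴴ
    ; sigχ⊆σ = λ ()
    ; φ⊨χ = λ _ _ _ → tt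
    ; strongest = λ ψ _ φ⊨ψ shared M w _ →
        let nom₀∉ψ : ¬ (nom 0 ∈ sig ψ)
            -- The third symbol of the instance is `c`, from the formula `⟨ Uᴿ ⟩ ⟨ Uᴿ ⟩ c` at the
            -- start of `theory`.
            nom₀∉ψ m = signature-observable h (shared m (there (there (here refl))))
        in decidable-stable em λ ¬ψ → Soundness.unsatisfiable em M d w λ x →
             decidable-stable em λ ¬θ →
               ¬ψ (Equivalence.to (reset-⇔ M x ψ _ nom₀∉ψ)
                     (φ⊨ψ (reset M x) w (Equivalence.to (T-correct (reset M x) [ w ] zero (inst (theory h) a b)) ¬θ)))
    }

  noInterpolant : ∀ {v} → h ⟦ a ∷ b ∷ [] ⟧⇓ suc v → ¬ ∃ (IsUniformInterpolant L (signature h) (T zero (inst (theory h) a b)))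
  noInterpolant {v} d (χ , isInterpolant)
    with (total d & always-bounded (a ∷ b ∷ []) & always-bounded (suc v ∷ []))
  ... | B , large-enough with large-enough ≤-refl
  ... | d , ba , bv = χ⊨¬diagram
    where
    open IsUniformInterpolant isInterpolant
    open Std h B
    n : ℕ
    -- The finite side is chosen after the interpolant, as long as the game on `χ` requires.
    n = cost χ
    open Game em h B n
    open Diagram em h B n (signature h)
    φ : H
    φ = inst (theory h) a b

    -- A model of both `φ` and the diagram would transfer `φ` to a standard model over `Fin n`,
    -- where `theory` and `root` hold whatever the hidden symbols denote.
    φ⊨¬diagram : T zero φ ⊨ T zero (¬ᴴ diagram)
    φ⊨¬diagram N v k j =
      transfer-root φ (inst-within h a b) (from (T-correct N [ v ] zero φ) k)
        (theory⊨ (finite-Fin n Q μ) , root⊨ ba bv d)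
      where
      open Equivalence
      open Transfer N v (from (T-correct N [ v ] zero diagram) j)
      open Verify D Q μ

    ν₁ : Nom → Pt ℕ
    ν₁ _ = top

    χ-infinite : std ℕ Succ ν₁ , [ top ] ⊨ᶠ χ
    χ-infinite = φ⊨χ _ top (Equivalence.to (T-correct (std ℕ Succ ν₁) [ top ] zero φ)
                              (λ ((_ , _ , ¬inf) , _) → ¬inf (infinite-ℕ ν₁)))

    -- The game starts with no coordinate picked. The hidden symbols may be interpreted differently
    -- on the two sides, as `χ` is written in observable symbols.
    χ-finite : M , [ top ] ⊨ᶠ χ
    χ-finite = preserve {Q = Succ} {λ _ → ⊥} {ν₁} {ν} (large toℕ toℕ-injective) (large id id) χ
                 (signature-observable h ∘ sigχ⊆σ) {xs = []} {[]} ≤-refl (match (λ ()) (λ ()))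
                 {ρ = [ top ]} (λ { zero → top }) χ-infinite

    χ⊨¬diagram : ⊥
    χ⊨¬diagram =
      strongest (T zero (¬ᴴ diagram)) (L⊇H (¬ᴴ diagram)) φ⊨¬diagram
        (λ s∈ψ s∈φ → [ id , (λ hid → contradiction hid (sig-noHidden diagram diagram-noHidden s∈ψ)) ]′
                       (sig-within {x = zero {0}} φ (inst-within h a b) s∈φ))
        M top χ-finite (Equivalence.to (T-correct M [ top ] zero diagram) diagram⊨)

-- Diagonalisation

numᴿ : Rec 1
numᴿ = prec (constᴿ (code {1} (T zero z)))
            (andᴿ (notᴿ (constᴿ (code {1} (T zero z)))) (boxᴿ Pᴿ (proj (suc zero))))

num⇓ : ∀ k {m} → numᴿ ⟦ k ∷ [] ⟧⇓ code (T {suc m} zero (num k))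
num⇓ zero    = ⇓prec₀ (atom⇓ 1)
num⇓ (suc k) = ⇓precₛ (num⇓ k) (and⇓ (not⇓ (atom⇓ 1)) (box⇓ Pᴿ (num k) (⇓proj (suc zero))))

rootᴿ : Rec 2
rootᴿ = diamondᴿ Uᴿ
  (andᴿ (diamondᴿ (V []) (notᴿ (constᴿ (code {1} (T zero z)))))
  (andᴿ (boxᴿ Hdᴿ (comp numᴿ (proj zero ∷ [])))
        (boxᴿ Tlᴿ (boxᴿ Hdᴿ (comp numᴿ (proj (suc zero) ∷ []))))))

root⇓ : ∀ a b → rootᴿ ⟦ a ∷ b ∷ [] ⟧⇓ code (T {1} zero (root a b))
root⇓ a b =
  diamond⇓ Uᴿ (⟨ V [] ⟩ ¬ᴴ z ∧ᴴ (□ Hdᴿ) (num a) ∧ᴴ (□ Tlᴿ) ((□ Hdᴿ) (num b)))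
    (and⇓ (diamond⇓ (V []) (¬ᴴ z) (not⇓ (atom⇓ 1)))
    (and⇓ (box⇓ Hdᴿ (num a) (⇓comp₁ (⇓proj zero) (num⇓ a)))
          (box⇓ Tlᴿ ((□ Hdᴿ) (num b)) (box⇓ Hdᴿ (num b) (⇓comp₁ (⇓proj (suc zero)) (num⇓ b))))))

-- Each seed serves twice: as a number described by `root`, and as a code, the first of the theory
-- and the second of the signature.
instᴿ : Rec 2
instᴿ = pairᴿ (notᴿ (andᴿ (proj zero) rootᴿ)) (proj (suc zero))

inst⇓ : ∀ A b → let a = code (T {1} zero A) in
        instᴿ ⟦ a ∷ b ∷ [] ⟧⇓ pair (codeFO (T {1} zero (inst A a b))) b
inst⇓ A b = pairCode⇓ (T {1} zero (inst A (code (T {1} zero A)) b)) b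
  (not⇓ (and⇓ (⇓proj zero) (root⇓ (code (T {1} zero A)) b))) (⇓proj (suc zero))

-- At the codes of its own theory and signature, `h` returns the answer of `f` on the instance built
-- from `h` with these seeds. If there were an interpolant, the answer 1 would exclude it; so the
-- answer is 0, which provides one.
diagonal : ExcludedMiddle 0ℓ → ∀ {ℓ} (L : Logic ℓ) → ContainsH L →
           ∀ {f} → Decides (codeInstance L) (HasUniformInterpolant L) f →
           ∀ h → h ≡ comp f (instᴿ ∷ []) → ⊥
diagonal em L L⊇H {f} decides h h≡ =
  refute (T zero (inst (theory h) (code (T {1} zero (theory h))) (codeSignature (signature h))))
         (L⊇H (inst (theory h) (code (T {1} zero (theory h))) (codeSignature (signature h))))
         (signature h)
         (inst⇓ (theory h) (codeSignature (signature h)))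
         (hasInterpolant em L L⊇H h (code (T {1} zero (theory h))) (codeSignature (signature h)))
         (noInterpolant em L L⊇H h (code (T {1} zero (theory h))) (codeSignature (signature h)))
  where
  refute : ∀ φ (φ∈L : L φ) σ {a b} →
           instᴿ ⟦ a ∷ b ∷ [] ⟧⇓ pair (codeFO φ) (codeSignature σ) →
           (h ⟦ a ∷ b ∷ [] ⟧⇓ 0 → ∃ (IsUniformInterpolant L σ φ)) →
           (h ⟦ a ∷ b ∷ [] ⟧⇓ 1 → ¬ ∃ (IsUniformInterpolant L σ φ)) → ⊥
  refute φ φ∈L σ {a} {b} d has hasNo =
    no-interpolant (has (run (proj₂ (decides ((φ , φ∈L) , σ)) no-interpolant)))
    where
    run : ∀ {v} → f ⟦ pair (codeFO φ) (codeSignature σ) ∷ [] ⟧⇓ v → h ⟦ a ∷ b ∷ [] ⟧⇓ v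
    run e = subst (λ k → k ⟦ a ∷ b ∷ [] ⟧⇓ _) (sym h≡) (⇓comp₁ d e)
    no-interpolant : ¬ ∃ (IsUniformInterpolant L σ φ)
    no-interpolant i = hasNo (run (proj₁ (decides ((φ , φ∈L) , σ)) i)) i

theorem3 : (∀ {a} → ExcludedMiddle a) → ∀ {ℓ} (L : Logic ℓ) → ContainsH L →
    Undecidable (codeInstance L) (HasUniformInterpolant L)
theorem3 em L L⊇H (f , decides) = diagonal em L L⊇H decides _ refl
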